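{- There are absolute constants $\varepsilon,\delta>0$ such that any $+n^{\delta}$-additive $3$-FT distance sensitivity oracle for a single pair $(s,t)$ in $n$-node undirected unweighted graphs uses $\Omega(n^{1+\varepsilon})$ bits of space in the worst case.
   Context: A $+\beta$-additive $f$-FT distance sensitivity oracle for a pair $(s,t)$ of a graph $G=(V,E)$ is a data structure (of arbitrary form) built from $G$ that, given any fault set $F\subseteq E$ with $|F|\leq f$, returns a value $\tilde d$ with $\mathrm{dist}_{G\setminus F}(s,t)\leq \tilde d\leq \mathrm{dist}_{G\setminus F}(s,t)+\beta$. The space bound means that over the class of $n$-node undirected unweighted graphs (with a designated pair), some graph requires a representation of $\Omega(n^{1+\varepsilon})$ bits. -}

module Defs where

open import Data.Nat using (ℕ; zero; suc; _+_; _*_; _^_; _≤_)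
open import Data.Fin using (Fin)
open import Data.Bool using (Bool; true)
open import Data.List using (List; length)
open import Data.List.Membership.Propositional using (_∈_)
open import Data.List.Relation.Unary.All using (All)
open import Data.Maybe using (Maybe; just; nothing)
open import Data.Product using (_×_; _,_; ∃)
open import Relation.Nullary using (¬_)
open import Relation.Binary.PropositionalEquality using (_≡_)

AdjMat : ℕ → Set
AdjMat n = Fin n → Fin n → Bool

IsGraph : ∀ {n} → AdjMat n → Set
IsGraph {n} G = (∀ (u v : Fin n) → G u v ≡ G v u) × (∀ (u : Fin n) → ¬ (G u u ≡ true))

-- Fault sets: lists of edges (u , v) (unordered reading: removing (u,v) removes {u,v}).
FaultSet : ℕ → Set
FaultSet n = List (Fin n × Fin n)

ValidFaults : ∀ {n} → ℕ → AdjMat n → FaultSet n → Set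
ValidFaults f G F = (length F ≤ f) × All (λ e → G (Data.Product.proj₁ e) (Data.Product.proj₂ e) ≡ true) F

AdjMinus : ∀ {n} → AdjMat n → FaultSet n → Fin n → Fin n → Set
AdjMinus G F u v = (G u v ≡ true) × ¬ ((u , v) ∈ F) × ¬ ((v , u) ∈ F)

data Walk {n} (G : AdjMat n) (F : FaultSet n) : Fin n → Fin n → ℕ → Set where
  here : ∀ {u} → Walk G F u u zero
  step : ∀ {u v w k} → AdjMinus G F u v → Walk G F v w k → Walk G F u w (suc k)

-- d̃ is a +β-approximation of dist_{G\F}(s,t); nothing encodes ∞.
--   dist = ∞  : no walk at all; returned value must be ∞.
--   dist < ∞ : dist ≤ d̃ ≤ dist + β, i.e. some walk has length ≤ d̃ and
--               every walk has length k with d̃ ≤ k + β.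
Approx : ∀ {n} → ℕ → AdjMat n → FaultSet n → Fin n → Fin n → Maybe ℕ → Set
Approx β G F s t nothing  = ∀ k → ¬ Walk G F s t k
Approx β G F s t (just d) = ∃ (λ k → Walk G F s t k × k ≤ d) × (∀ k → Walk G F s t k → d ≤ k + β)

IsOracle : (n f β : ℕ) →
           (AdjMat n → Fin n → Fin n → List Bool) →
           (List Bool → FaultSet n → Maybe ℕ) → Set
IsOracle n f β enc query =
  ∀ (G : AdjMat n) (s t : Fin n) → IsGraph G →
  ∀ (F : FaultSet n) → ValidFaults f G F →
  Approx β G F s t (query (enc G s t) F)

{-# OPTIONS --safe #-}

-- Let u₁, u₂ be the slopes of straight lines in two blocks of coordinates, from (x₁, x₂) to
-- (z₁, z₂). The network follows the two lines in turn, ℓ times, along edges subdivided to length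
-- D (K + |uᵢ|²), and changes from the first to the second through an edge that is present iff the
-- bit χ ((x₁ , x₂) , (z₁ , z₂)) is set; as the edge determines both lines, no two pairs share one.
-- By strict convexity of |u|², leaving the lines costs at least D = 2ℓ, while staying on them
-- without these edges costs at least 1 more per round. A bit is thus visible as a gap ℓ in one
-- distance, which is certified by a 1-Lipschitz potential built from the supporting hyperplanes
-- of |u|². Two faults select the start among #X² ones hanging from s in a tree of depth two, the
-- third fault selects the end among #Z² ones hanging from t. For #X = m^128 and #Z = m^96 there
-- are m^448 bits, on at most m^446 vertices, so some graph needs m^448 bits of encoding.
module Submission where

open import Defs
open import Data.Bool using (Bool; true; false)
open import Data.Bool.Properties as Bool using ()
open import Data.Fin using (Fin; zero; suc; toℕ; fromℕ; fromℕ<; inject₁; splitAt; _↑ˡ_; finToFun; funToFin; combine)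
open import Data.Fin.Induction using (<-weakInduction)
open import Data.Fin.Properties as Fin
  using (any?; pigeonhole; splitAt-↑ˡ; toℕ<n; toℕ-fromℕ; toℕ-fromℕ<; toℕ-inject₁; toℕ-injective; funToFin-finToFin)
open import Data.List using (List; []; _∷_; length; map)
open import Data.List.Membership.Propositional using (_∉_)
open import Data.List.Membership.Propositional.Properties using (∈-map⁺; ∈-map⁻)
open import Data.List.Relation.Unary.All as All using (All; []; _∷_)
open import Data.List.Relation.Unary.Any using (here; there)
open import Data.Maybe using (Maybe; just; nothing; maybe)
open import Data.Maybe.Properties using (just-injective)
open import Data.Nat
open import Data.Nat.Properties
open import Data.Nat.Tactic.RingSolver using (solve-∀)
open import Data.Product using (_×_; _,_; ∃; ∃-syntax; Σ; proj₁; proj₂; swap)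
open import Data.Product.Function.NonDependent.Propositional using (_×-↔_)
open import Data.Sum as Sum using (_⊎_; inj₁; inj₂; [_,_]′)
open import Data.Sum.Function.Propositional using (_⊎-↔_)
open import Data.Sum.Properties using (inj₁-injective; inj₂-injective)
open import Data.Unit using (⊤; tt)
open import Function using (_∘_; const; _↔_; Inverse; mk↔ₛ′; mk⇔)
open import Function.Construct.Composition using (_↔-∘_)
open import Function.Construct.Identity using (↔-id)
open import Function.Construct.Symmetry using (↔-sym)
open import Function.Properties.Inverse using (↔⇒↣)
open import Relation.Binary.Definitions using (DecidableEquality)
open import Relation.Binary.PropositionalEquality
open import Relation.Nullary
open import Relation.Nullary.Decidable using (does-⇔; dec-true; from-yes; map′; via-injection)

-- Graphs as unions of subdivided edges

Near : ℕ → ℕ → ℕ → Set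
Near k x y = x ≤ y + k × y ≤ x + k

near-refl : ∀ {k x y} → x ≡ y → Near k x y
near-refl refl = m≤m+n _ _ , m≤m+n _ _

near-⊓ : ∀ {k x x′ y y′} → Near k x x′ → Near k y y′ → Near k (x ⊓ y) (x′ ⊓ y′)
near-⊓ {k} (p , p′) (q , q′) =
  ≤-trans (⊓-mono-≤ p q) (≤-reflexive (sym (+-distribʳ-⊓ k _ _))) ,
  ≤-trans (⊓-mono-≤ p′ q′) (≤-reflexive (sym (+-distribʳ-⊓ k _ _)))

does⇒ : ∀ {a} {A : Set a} (d : Dec A) → does d ≡ true → A
does⇒ (yes a) _ = a

walk-++ : ∀ {n} {G : AdjMat n} {F x y z j k} → Walk G F x y j → Walk G F y z k → Walk G F x z (j + k)
walk-++ here       w = w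
walk-++ (step a v) w = step a (walk-++ v w)

∃-dec : ∀ {A : Set} {n} → A ↔ Fin n → {P : A → Set} → (∀ x → Dec (P x)) → Dec (∃ P)
∃-dec A↔ {P} P? = map′ (λ (i , p) → from i , p)
                       (λ (x , p) → to x , subst P (sym (strictlyInverseʳ x)) p)
                       (any? (P? ∘ from))
  where open Inverse A↔

↔-≟ : ∀ {A : Set} {n} → A ↔ Fin n → DecidableEquality A
↔-≟ A↔ = via-injection (↔⇒↣ A↔) Fin._≟_

infixr 2 _×-code_
infixr 1 _⊎-code_

_×-code_ : ∀ {A B : Set} {m n} → A ↔ Fin m → B ↔ Fin n → (A × B) ↔ Fin (m * n)
A↔ ×-code B↔ = ↔-sym Fin.*↔× ↔-∘ (A↔ ×-↔ B↔)

_⊎-code_ : ∀ {A B : Set} {m n} → A ↔ Fin m → B ↔ Fin n → (A ⊎ B) ↔ Fin (m + n)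
A↔ ⊎-code B↔ = ↔-sym Fin.+↔⊎ ↔-∘ (A↔ ⊎-↔ B↔)

-- The vertices outside the image of V are isolated.
module SegmentGraph {V Seg : Set} {N M : ℕ} (V↔ : V ↔ Fin N) (Seg↔ : Seg ↔ Fin M)
                    (left right : Seg → V) (extra : ℕ) where

  abstract
    vtx : V → Fin (N + extra)
    vtx v = Inverse.to V↔ v ↑ˡ extra

    unvtx : Fin (N + extra) → Maybe V
    unvtx x = [ just ∘ Inverse.from V↔ , const nothing ]′ (splitAt N x)

    unvtx-vtx : ∀ v → unvtx (vtx v) ≡ just v
    unvtx-vtx v rewrite splitAt-↑ˡ N (Inverse.to V↔ v) extra = cong just (Inverse.strictlyInverseʳ V↔ v)

  vtx-injective : ∀ {v w} → vtx v ≡ vtx w → v ≡ w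
  vtx-injective {v} {w} eq = just-injective (trans (sym (unvtx-vtx v)) (trans (cong unvtx eq) (unvtx-vtx w)))

  Joins : Fin (N + extra) → Fin (N + extra) → Seg → Set
  Joins x y g = (vtx (left g) ≡ x × vtx (right g) ≡ y) ⊎ (vtx (left g) ≡ y × vtx (right g) ≡ x)

  -- The clause `x ≢ y` removes loops: segments may be degenerate, as happens to the surplus
  -- segments of a long edge, indexed past its end.
  Adj : (Seg → Bool) → Fin (N + extra) → Fin (N + extra) → Set
  Adj on x y = x ≢ y × ∃ λ g → on g ≡ true × Joins x y g

  adj-sym : ∀ {on x y} → Adj on x y → Adj on y x
  adj-sym (x≢y , g , on , j) = x≢y ∘ sym , g , on , Sum.swap j

  abstract
    adj? : ∀ on x y → Dec (Adj on x y)
    adj? on x y = ¬? (x Fin.≟ y) ×-dec ∃-dec Seg↔ (λ g → (on g Bool.≟ true) ×-dec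
      (((vtx (left g) Fin.≟ x) ×-dec (vtx (right g) Fin.≟ y)) ⊎-dec
       ((vtx (left g) Fin.≟ y) ×-dec (vtx (right g) Fin.≟ x))))

    graph : (Seg → Bool) → AdjMat (N + extra)
    graph on x y = does (adj? on x y)

    graph-isGraph : ∀ on → IsGraph (graph on)
    graph-isGraph on =
      (λ x y → does-⇔ (mk⇔ adj-sym adj-sym) (adj? on x y) (adj? on y x)) ,
      (λ x e → proj₁ (does⇒ (adj? on x x) e) refl)

    graph-seg : ∀ {on} g → on g ≡ true → left g ≢ right g → graph on (vtx (left g)) (vtx (right g)) ≡ true
    graph-seg {on} g og l≢r = dec-true (adj? on _ _) (l≢r ∘ vtx-injective , g , og , inj₁ (refl , refl))

    graph-sound : ∀ {on x y} → graph on x y ≡ true → Adj on x y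
    graph-sound {on} {x} {y} = does⇒ (adj? on x y)

  level : (V → ℕ) → Fin (N + extra) → ℕ
  level φ x = maybe φ 0 (unvtx x)

  level-vtx : ∀ φ v → level φ (vtx v) ≡ φ v
  level-vtx φ v = cong (maybe φ 0) (unvtx-vtx v)

  -- A 1-Lipschitz potential rises by at most 1 per step. Testing faults in the orientation from
  -- `left` to `right` suffices, because `AdjMinus` excludes both orientations.
  walk-lower : ∀ {on F} φ →
               (∀ g → on g ≡ true → (vtx (left g) , vtx (right g)) ∉ F → Near 1 (φ (left g)) (φ (right g))) →
               ∀ {x y k} → Walk (graph on) F x y k → level φ y ≤ level φ x + k
  walk-lower φ lip here = m≤m+n _ _
  walk-lower {on} {F} φ lip {x} {z} (step {v = y} {k = k} (e , xy∉F , yx∉F) w) = begin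
    level φ z               ≤⟨ walk-lower φ lip w ⟩
    level φ y + k           ≤⟨ +-monoˡ-≤ k (climb (proj₂ (graph-sound e))) ⟩
    level φ x + 1 + k       ≡⟨ +-assoc (level φ x) 1 k ⟩
    level φ x + suc k       ∎
    where
    open ≤-Reasoning
    climb : (∃ λ g → on g ≡ true × Joins x y g) → level φ y ≤ level φ x + 1
    climb (g , og , inj₁ (refl , refl))
      rewrite level-vtx φ (left g) | level-vtx φ (right g) = proj₂ (lip g og xy∉F)
    climb (g , og , inj₂ (refl , refl))
      rewrite level-vtx φ (left g) | level-vtx φ (right g) = proj₁ (lip g og yx∉F)

  -- The length is only an upper bound, since a degenerate segment is crossed in 0 steps.
  record Conn (on : Seg → Bool) (F : FaultSet (N + extra)) (v w : V) (k : ℕ) : Set where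
    constructor conn
    field
      {steps} : ℕ
      steps≤  : steps ≤ k
      walk    : Walk (graph on) F (vtx v) (vtx w) steps

  conn-refl : ∀ {on F v} → Conn on F v v 0
  conn-refl = conn z≤n here

  conn-trans : ∀ {on F u v w j k} → Conn on F u v j → Conn on F v w k → Conn on F u w (j + k)
  conn-trans (conn i≤ p) (conn j≤ q) = conn (+-mono-≤ i≤ j≤) (walk-++ p q)

  conn-seg : ∀ {on F} g → on g ≡ true → (vtx (left g) , vtx (right g)) ∉ F → (vtx (right g) , vtx (left g)) ∉ F →
             Conn on F (left g) (right g) 1
  conn-seg {on} {F} g og lr∉F rl∉F with vtx (left g) Fin.≟ vtx (right g)
  ... | yes l≡r = conn z≤n (subst (λ x → Walk (graph on) F (vtx (left g)) x 0) l≡r here)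
  ... | no  l≢r = conn ≤-refl (step (graph-seg {on} g og (l≢r ∘ cong vtx) , lr∉F , rl∉F) here)

-- A graph with unit edges U and long edges E, where the long edge e is subdivided into
-- a path with len e unit segments.
module Subdivision {B U E : Set} {cap : E → ℕ} {#B #U #I : ℕ}
  (B↔ : B ↔ Fin #B) (U↔ : U ↔ Fin #U) (I↔ : Σ E (Fin ∘ cap) ↔ Fin #I)
  (usrc utgt : U → B) (src tgt : E → B)
  (len : E → ℕ) (len>0 : ∀ e → 0 < len e) (len≤cap : ∀ e → len e ≤ cap e) (extra : ℕ) where

  V Seg : Set
  V = B ⊎ Σ E (Fin ∘ cap)
  Seg = U ⊎ Σ E (Fin ∘ cap)

  -- `cap` overestimates `len` so that interior points can be counted by products. From `len e` on
  -- every index yields the target, so surplus segments are loops and surplus vertices stay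
  -- isolated.
  point : E → ℕ → V
  point e zero = inj₁ (src e)
  point e (suc j) with suc j <? len e
  ... | yes j<len = inj₂ (e , fromℕ< (<-≤-trans j<len (len≤cap e)))
  ... | no  _     = inj₁ (tgt e)

  left right : Seg → V
  left (inj₁ u)        = inj₁ (usrc u)
  left (inj₂ (e , i))  = point e (toℕ i)
  right (inj₁ u)       = inj₁ (utgt u)
  right (inj₂ (e , i)) = point e (suc (toℕ i))

  open SegmentGraph (B↔ ⊎-code I↔) (U↔ ⊎-code I↔) left right extra public

  size : ℕ
  size = #B + #I

  switch : (U → Bool) → Seg → Bool
  switch bit = [ bit , const true ]′

  base : B → Fin (size + extra)
  base = vtx ∘ inj₁

  faults : List (B × B) → FaultSet (size + extra)
  faults = map (λ (x , y) → base x , base y)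

  point-end : ∀ e → point e (len e) ≡ inj₁ (tgt e)
  point-end e with len e in eq | len>0 e
  ... | suc j | _ with suc j <? len e
  ...   | yes j<len = contradiction (subst (suc j <_) eq j<len) (<-irrefl refl)
  ...   | no  _     = refl

  -- The largest 1-Lipschitz function on a path of length `L` that is at most `a` and `b` at its
  -- ends. It attains both values exactly when they are `Near L`.
  along : ℕ → ℕ → ℕ → ℕ → ℕ
  along a b L j = (a + j) ⊓ (b + (L ∸ j))

  along-near : ∀ a b L j → Near 1 (along a b L j) (along a b L (suc j))
  along-near a b L j = near-⊓
    ( ≤-trans (+-monoʳ-≤ a (n≤1+n j)) (m≤m+n _ 1)
    , ≤-reflexive (trans (+-suc a j) (+-comm 1 (a + j))))
    ( ≤-trans (+-monoʳ-≤ b (≤-trans (m≤n+m∸n _ 1) (≤-reflexive (+-comm 1 _))))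
        (≤-reflexive (trans (sym (+-assoc b _ 1)) (cong (λ k → b + k + 1) (trans (∸-+-assoc L j 1) (cong (L ∸_) (+-comm j 1))))))
    , ≤-trans (+-monoʳ-≤ b (∸-monoʳ-≤ L (n≤1+n j))) (m≤m+n _ 1))

  extend : (B → ℕ) → V → ℕ
  extend φ (inj₁ b)       = φ b
  extend φ (inj₂ (e , i)) = along (φ (src e)) (φ (tgt e)) (len e) (toℕ i)

  extend-point : ∀ φ e → Near (len e) (φ (src e)) (φ (tgt e)) → ∀ j →
                 extend φ (point e j) ≡ along (φ (src e)) (φ (tgt e)) (len e) j
  extend-point φ e (s≤ , t≤) zero = sym (trans (m≤n⇒m⊓n≡m (≤-trans (≤-reflexive (+-identityʳ _)) s≤)) (+-identityʳ _))
  extend-point φ e (s≤ , t≤) (suc j) with suc j <? len e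
  ... | yes j<len = cong (along (φ (src e)) (φ (tgt e)) (len e)) (toℕ-fromℕ< _)
  -- Past the end, truncated subtraction freezes the second term at the target value. This is the
  -- minimum since `φ (tgt e) ≤ φ (src e) + len e`.
  ... | no  j≮len = sym (trans (m≥n⇒m⊓n≡n (≤-trans (≤-reflexive end) (≤-trans t≤ (+-monoʳ-≤ _ (≮⇒≥ j≮len))))) end)
    where
    end : φ (tgt e) + (len e ∸ suc j) ≡ φ (tgt e)
    end = trans (cong (φ (tgt e) +_) (m≤n⇒m∸n≡0 (≮⇒≥ j≮len))) (+-identityʳ _)

  potential-lower : ∀ {bit Fb} φ →
    (∀ u → bit u ≡ true → (usrc u , utgt u) ∉ Fb → Near 1 (φ (usrc u)) (φ (utgt u))) →
    (∀ e → Near (len e) (φ (src e)) (φ (tgt e))) →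
    ∀ {s t k} → Walk (graph (switch bit)) (faults Fb) (base s) (base t) k → φ t ≤ φ s + k
  potential-lower {bit} {Fb} φ unit long {s} {t} {k} w =
    subst₂ (λ x y → x ≤ y + k) (level-vtx (extend φ) (inj₁ t)) (level-vtx (extend φ) (inj₁ s))
      (walk-lower (extend φ) lip w)
    where
    lip : ∀ g → switch bit g ≡ true → (vtx (left g) , vtx (right g)) ∉ faults Fb →
          Near 1 (extend φ (left g)) (extend φ (right g))
    lip (inj₁ u) on ∉F = unit u on (∉F ∘ ∈-map⁺ _)
    lip (inj₂ (e , i)) _ _
      rewrite extend-point φ e (long e) (toℕ i) | extend-point φ e (long e) (suc (toℕ i)) =
      along-near (φ (src e)) (φ (tgt e)) (len e) (toℕ i)

  -- Faults join base vertices. A route therefore avoids them once its base vertices lie in a set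
  -- `Ok` that contains both ends of no fault; interior points are harmless.
  module Clear {bit : U → Bool} {Fb : List (B × B)} (Ok : B → Set)
               (hit : All (λ (x , y) → ¬ (Ok x × Ok y)) Fb) where

    Clear : V → Set
    Clear (inj₁ b) = Ok b
    Clear (inj₂ _) = ⊤

    avoid : ∀ {v w} → Clear v → Clear w → (vtx v , vtx w) ∉ faults Fb
    avoid {v} {w} cv cw vw∈F with ∈-map⁻ _ vw∈F
    ... | (x , y) , xy∈Fb , eq with vtx-injective {v} {inj₁ x} (cong proj₁ eq) | vtx-injective {w} {inj₁ y} (cong proj₂ eq)
    ... | refl | refl = All.lookup hit xy∈Fb (cv , cw)

    Path : B → B → ℕ → Set
    Path x y = Conn (switch bit) (faults Fb) (inj₁ x) (inj₁ y)

    path-unit : ∀ u → bit u ≡ true → Ok (usrc u) → Ok (utgt u) → Path (usrc u) (utgt u) 1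
    path-unit u on s t = conn-seg (inj₁ u) on (avoid {inj₁ _} {inj₁ _} s t) (avoid {inj₁ _} {inj₁ _} t s)

    path-long : ∀ e → Ok (src e) → Ok (tgt e) → Path (src e) (tgt e) (len e)
    path-long e s t = subst (λ v → Conn _ _ (inj₁ (src e)) v (len e)) (point-end e) (go (len e) ≤-refl)
      where
      clear : ∀ j → Clear (point e j)
      clear zero = s
      clear (suc j) with suc j <? len e
      ... | yes _ = tt
      ... | no  _ = t
      go : ∀ j → j ≤ len e → Conn (switch bit) (faults Fb) (inj₁ (src e)) (point e j) j
      go zero _ = conn-refl
      go (suc j) j<len = subst (Conn _ _ _ _) (+-comm j 1) (conn-trans (go j (<⇒≤ j<len)) next)
        where
        i : Fin (cap e)
        i = fromℕ< (≤-trans j<len (len≤cap e))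
        next : Conn (switch bit) (faults Fb) (point e j) (point e (suc j)) 1
        next = subst (λ j → Conn (switch bit) (faults Fb) (point e j) (point e (suc j)) 1) (toℕ-fromℕ< _)
          (conn-seg (inj₂ (e , i)) refl (avoid {point e (toℕ i)} {point e (suc (toℕ i))} (clear (toℕ i)) (clear (suc (toℕ i))))
                                        (avoid {point e (suc (toℕ i))} {point e (toℕ i)} (clear (suc (toℕ i))) (clear (toℕ i))))

-- Trajectories with strictly convex weights

-- Clamping makes positions total in the round number; for rounds up to `ℓ` they are in range and
-- nothing is lost.
clip : ∀ n → ℕ → Fin (suc n)
clip n i = fromℕ< (s≤s (m⊓n≤n i n))

toℕ-clip : ∀ {n i} → i ≤ n → toℕ (clip n i) ≡ i
toℕ-clip i≤n = trans (toℕ-fromℕ< _) (m≤n⇒m⊓n≡m i≤n)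

-- This measures how far the parabola lies above its supporting line: v² = (2uv - u²) + (u - v)².
-- The last term is the slack of a line.
∣-∣-square : ∀ a b → a * a + b * b ≡ 2 * (a * b) + ∣ a - b ∣ * ∣ a - b ∣
∣-∣-square a b = [ go a b , flip ]′ (≤-total a b)
  where
  ring : ∀ a d → a * a + (a + d) * (a + d) ≡ 2 * (a * (a + d)) + d * d
  ring = solve-∀
  go : ∀ a b → a ≤ b → a * a + b * b ≡ 2 * (a * b) + ∣ a - b ∣ * ∣ a - b ∣
  go a b a≤b with m≤n⇒∃[o]m+o≡n a≤b
  ... | d , refl rewrite ∣m-m+n∣≡n a d = ring a d
  flip : b ≤ a → a * a + b * b ≡ 2 * (a * b) + ∣ a - b ∣ * ∣ a - b ∣
  flip b≤a rewrite +-comm (a * a) (b * b) | *-comm a b | ∣-∣-comm a b = go b a b≤a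

-- pos r x z (r ≤ ℓ) is a trajectory from first x to last z. The potential of the trajectory
-- (x*, z*) grows along any other one by its weight minus a nonnegative slack, and a trajectory
-- with slack 0 is parallel to (x*, z*), so it equals it as soon as they meet.
record Block (ℓ : ℕ) : Set₁ where
  field
    X Z Y            : Set
    #X #Z #Y         : ℕ
    X↔               : X ↔ Fin #X
    Z↔               : Z ↔ Fin #Z
    Y↔               : Y ↔ Fin #Y
    pos              : ℕ → X → Z → Y
    first            : X → Y
    last             : Z → Y
    pos-first        : ∀ x z → pos 0 x z ≡ first x
    pos-last         : ∀ x z → pos ℓ x z ≡ last z
    weight           : X → Z → ℕ
    slack            : X → Z → X → Z → ℕ
    pot              : X → Z → ℕ → Y → ℕ
    maxWeight maxPot : ℕ
    weight≤          : ∀ x z → weight x z ≤ maxWeight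
    slack≤           : ∀ x* z* x z → slack x* z* x z ≤ maxWeight
    pot≤             : ∀ x z r y → pot x z r y ≤ maxPot
    pot-step         : ∀ x* z* {r} → r < ℓ → ∀ x z →
                       pot x* z* (suc r) (pos (suc r) x z) + slack x* z* x z ≡ pot x* z* r (pos r x z) + weight x z
    slack-self       : ∀ x z → slack x z x z ≡ 0
    rigid            : ∀ x* z* x z {r} → r ≤ ℓ → slack x* z* x z ≡ 0 → pos r x z ≡ pos r x* z* → x ≡ x* × z ≡ z*

-- Straight lines: the slope A − x + z is shifted by A to be a natural number, its square is the
-- weight, and the potential is the supporting line 2 u* y − r u*², up to the constant ℓ u*².
line : ∀ ℓ → 0 < ℓ → ℕ → ℕ → Block ℓ
line ℓ ℓ>0 A C = record
  { X = Fin A ; Z = Fin C ; Y = Fin (suc Y)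
  ; X↔ = ↔-id _ ; Z↔ = ↔-id _ ; Y↔ = ↔-id _
  ; pos = λ r x z → clip Y (at r x z)
  -- Both ends are multiples of `ℓ`, so the slope over `ℓ` rounds is an integer.
  ; first = λ x → clip Y (ℓ * toℕ x)
  ; last = λ z → clip Y (ℓ * (A + toℕ z))
  ; pos-first = λ x z → cong (clip Y) (+-identityʳ _)
  ; pos-last = λ x z → cong (clip Y) (at-last x z)
  ; weight = λ x z → slope x z * slope x z
  ; slack = slack′
  ; pot = pot′
  ; maxWeight = (A + C) * (A + C)
  ; maxPot = 2 * ((A + C) * Y) + ℓ * ((A + C) * (A + C))
  ; weight≤ = λ x z → *-mono-≤ (slope≤ x z) (slope≤ x z)
  ; slack≤ = λ x* z* x z → *-mono-≤ (diff≤ x* z* x z) (diff≤ x* z* x z)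
  ; pot≤ = λ x z r y → +-mono-≤ (*-monoʳ-≤ 2 (*-mono-≤ (slope≤ x z) (≤-pred (toℕ<n y))))
                                (*-mono-≤ (m∸n≤m ℓ r) (*-mono-≤ (slope≤ x z) (slope≤ x z)))
  ; pot-step = advance
  ; slack-self = λ x z → cong (λ d → d * d) (∣n-n∣≡0 (slope x z))
  ; rigid = rigid′
  }
  where
  Y : ℕ
  Y = ℓ * (A + C)
  slope : Fin A → Fin C → ℕ
  slope x z = A ∸ toℕ x + toℕ z
  slope≤ : ∀ x z → slope x z ≤ A + C
  slope≤ x z = +-mono-≤ (m∸n≤m A (toℕ x)) (<⇒≤ (toℕ<n z))
  diff≤ : ∀ x* z* x z → ∣ slope x* z* - slope x z ∣ ≤ A + C
  diff≤ x* z* x z = ≤-trans (∣m-n∣≤m⊔n (slope x* z*) (slope x z)) (⊔-lub (slope≤ x* z*) (slope≤ x z))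
  at : ℕ → Fin A → Fin C → ℕ
  at r x z = ℓ * toℕ x + r * slope x z
  at-last : ∀ x z → at ℓ x z ≡ ℓ * (A + toℕ z)
  at-last x z = trans (sym (*-distribˡ-+ ℓ (toℕ x) _)) (cong (ℓ *_)
    (trans (sym (+-assoc (toℕ x) _ _)) (cong (_+ toℕ z) (m+[n∸m]≡n (<⇒≤ (toℕ<n x))))))
  at≤ : ∀ {r} → r ≤ ℓ → ∀ x z → at r x z ≤ Y
  at≤ r≤ℓ x z = ≤-trans (+-monoʳ-≤ (ℓ * toℕ x) (*-monoˡ-≤ (slope x z) r≤ℓ))
    (≤-trans (≤-reflexive (at-last x z)) (*-monoʳ-≤ ℓ (+-monoʳ-≤ A (<⇒≤ (toℕ<n z)))))
  pot′ : Fin A → Fin C → ℕ → Fin (suc Y) → ℕ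
  pot′ x z r y = 2 * (slope x z * toℕ y) + (ℓ ∸ r) * (slope x z * slope x z)
  slack′ : Fin A → Fin C → Fin A → Fin C → ℕ
  slack′ x* z* x z = ∣ slope x* z* - slope x z ∣ * ∣ slope x* z* - slope x z ∣
  advance : ∀ x* z* {r} → r < ℓ → ∀ x z →
         pot′ x* z* (suc r) (clip Y (at (suc r) x z)) + slack′ x* z* x z ≡
         pot′ x* z* r (clip Y (at r x z)) + slope x z * slope x z
  advance x* z* {r} r<ℓ x z
    rewrite toℕ-clip (at≤ r<ℓ x z) | toℕ-clip (at≤ (<⇒≤ r<ℓ) x z) | +-∸-assoc 1 r<ℓ
    = lemma (slope x* z*) (slope x z) (ℓ * toℕ x) r (ℓ ∸ suc r) _ (∣-∣-square (slope x* z*) (slope x z))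
    where
    lhs : ∀ u v p r k d → 2 * (u * (p + (v + r * v))) + k * (u * u) + d ≡
                          2 * (u * (p + r * v)) + k * (u * u) + (2 * (u * v) + d)
    lhs = solve-∀
    rhs : ∀ u v p r k → 2 * (u * (p + r * v)) + k * (u * u) + (u * u + v * v) ≡
                        2 * (u * (p + r * v)) + (u * u + k * (u * u)) + v * v
    rhs = solve-∀
    lemma : ∀ u v p r k d → u * u + v * v ≡ 2 * (u * v) + d →
            2 * (u * (p + (v + r * v))) + k * (u * u) + d ≡
            2 * (u * (p + r * v)) + (u * u + k * (u * u)) + v * v
    lemma u v p r k d eq = trans (lhs u v p r k d)
      (trans (cong (2 * (u * (p + r * v)) + k * (u * u) +_) (sym eq)) (rhs u v p r k))
  rigid′ : ∀ x* z* x z {r} → r ≤ ℓ → slack′ x* z* x z ≡ 0 → clip Y (at r x z) ≡ clip Y (at r x* z*) →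
           x ≡ x* × z ≡ z*
  rigid′ x* z* x z {r} r≤ℓ sl≡0 pos≡ = x≡ , z≡
    where
    slope≡ : slope x* z* ≡ slope x z
    slope≡ = ∣m-n∣≡0⇒m≡n (Sum.reduce (m*n≡0⇒m≡0∨n≡0 _ sl≡0))
    at≡ : at r x z ≡ at r x* z*
    at≡ = trans (sym (toℕ-clip (at≤ r≤ℓ x z))) (trans (cong toℕ pos≡) (toℕ-clip (at≤ r≤ℓ x* z*)))
    x≡ : x ≡ x*
    x≡ = toℕ-injective (*-cancelˡ-≡ _ _ ℓ ⦃ >-nonZero ℓ>0 ⦄ (+-cancelʳ-≡ (r * slope x z) _ _
      (trans at≡ (cong (λ u → ℓ * toℕ x* + r * u) slope≡))))
    z≡ : z ≡ z*
    z≡ = toℕ-injective (+-cancelˡ-≡ (A ∸ toℕ x) _ _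
      (trans (sym slope≡) (cong (λ x → A ∸ toℕ x + toℕ z*) (sym x≡))))

point-block : ∀ ℓ → Block ℓ
point-block ℓ = record
  { X = ⊤ ; Z = ⊤ ; Y = ⊤ ; #X = 1 ; #Z = 1 ; #Y = 1
  ; X↔ = ↔-sym Fin.1↔⊤ ; Z↔ = ↔-sym Fin.1↔⊤ ; Y↔ = ↔-sym Fin.1↔⊤
  ; pos = λ _ _ _ → tt ; first = λ _ → tt ; last = λ _ → tt
  ; pos-first = λ _ _ → refl ; pos-last = λ _ _ → refl
  ; weight = λ _ _ → 0 ; slack = λ _ _ _ _ → 0 ; pot = λ _ _ _ _ → 0 ; maxWeight = 0 ; maxPot = 0
  ; weight≤ = λ _ _ → z≤n ; slack≤ = λ _ _ _ _ → z≤n ; pot≤ = λ _ _ _ _ → z≤n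
  ; pot-step = λ _ _ _ _ _ → refl ; slack-self = λ _ _ → refl ; rigid = λ _ _ _ _ _ _ _ → refl , refl }

_⊗_ : ∀ {ℓ} → Block ℓ → Block ℓ → Block ℓ
P ⊗ Q = record
  { X = P.X × Q.X ; Z = P.Z × Q.Z ; Y = P.Y × Q.Y
  ; X↔ = P.X↔ ×-code Q.X↔
  ; Z↔ = P.Z↔ ×-code Q.Z↔
  ; Y↔ = P.Y↔ ×-code Q.Y↔
  ; pos = λ r (x , x′) (z , z′) → P.pos r x z , Q.pos r x′ z′
  ; first = λ (x , x′) → P.first x , Q.first x′
  ; last = λ (z , z′) → P.last z , Q.last z′
  ; pos-first = λ (x , x′) (z , z′) → cong₂ _,_ (P.pos-first x z) (Q.pos-first x′ z′)
  ; pos-last = λ (x , x′) (z , z′) → cong₂ _,_ (P.pos-last x z) (Q.pos-last x′ z′)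
  ; weight = λ (x , x′) (z , z′) → P.weight x z + Q.weight x′ z′
  ; slack = λ (x* , x*′) (z* , z*′) (x , x′) (z , z′) → P.slack x* z* x z + Q.slack x*′ z*′ x′ z′
  ; pot = λ (x , x′) (z , z′) r (y , y′) → P.pot x z r y + Q.pot x′ z′ r y′
  ; maxWeight = P.maxWeight + Q.maxWeight
  ; maxPot = P.maxPot + Q.maxPot
  ; weight≤ = λ _ _ → +-mono-≤ (P.weight≤ _ _) (Q.weight≤ _ _)
  ; slack≤ = λ _ _ _ _ → +-mono-≤ (P.slack≤ _ _ _ _) (Q.slack≤ _ _ _ _)
  ; pot≤ = λ _ _ _ _ → +-mono-≤ (P.pot≤ _ _ _ _) (Q.pot≤ _ _ _ _)
  ; pot-step = λ (x* , x*′) (z* , z*′) {r} r<ℓ (x , x′) (z , z′) →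
      +-combine (P.pot x* z* (suc r) _) (P.slack x* z* x z) (P.pot x* z* r _)
              (P.pot-step x* z* r<ℓ x z) (Q.pot-step x*′ z*′ r<ℓ x′ z′)
  ; slack-self = λ _ _ → cong₂ _+_ (P.slack-self _ _) (Q.slack-self _ _)
  ; rigid = λ (x* , x*′) (z* , z*′) (x , x′) (z , z′) r≤ℓ sl≡0 pos≡ →
      let (x≡ , z≡) = P.rigid x* z* x z r≤ℓ (m+n≡0⇒m≡0 _ sl≡0) (cong proj₁ pos≡)
          (x′≡ , z′≡) = Q.rigid x*′ z*′ x′ z′ r≤ℓ (m+n≡0⇒n≡0 (P.slack x* z* x z) sl≡0) (cong proj₂ pos≡)
      in cong₂ _,_ x≡ x′≡ , cong₂ _,_ z≡ z′≡
  }
  where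
  module P = Block P
  module Q = Block Q
  interchange : ∀ a b c d → (a + b) + (c + d) ≡ (a + c) + (b + d)
  interchange = solve-∀
  +-combine : ∀ p s q {w p′ s′ q′ w′} → p + s ≡ q + w → p′ + s′ ≡ q′ + w′ → (p + p′) + (s + s′) ≡ (q + q′) + (w + w′)
  +-combine p s q {w} {p′} {s′} {q′} {w′} e e′ =
    trans (interchange p p′ s s′) (trans (cong₂ _+_ e e′) (interchange q w q′ w′))

grid : ∀ ℓ → 0 < ℓ → (d A C : ℕ) → Block ℓ
grid ℓ ℓ>0 zero    A C = point-block ℓ
grid ℓ ℓ>0 (suc d) A C = line ℓ ℓ>0 A C ⊗ grid ℓ ℓ>0 d A C

-- Lipschitz potentials

choose : ∀ {P : Set} → Dec P → ℕ → ℕ → ℕ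
choose (yes _) a b = a
choose (no  _) a b = b

near-mono : ∀ {j k x y} → j ≤ k → Near j x y → Near k x y
near-mono {x = x} {y} j≤k (p , q) = ≤-trans p (+-monoʳ-≤ y j≤k) , ≤-trans q (+-monoʳ-≤ x j≤k)

near-+ : ∀ o {k x y} → Near k x y → Near k (o + x) (o + y)
near-+ o (p , q) = ≤-trans (+-monoʳ-≤ o p) (≤-reflexive (sym (+-assoc o _ _))) ,
                   ≤-trans (+-monoʳ-≤ o q) (≤-reflexive (sym (+-assoc o _ _)))

near-bounded : ∀ {M x y} → x ≤ M → y ≤ M → Near M x y
near-bounded x≤M y≤M = ≤-trans x≤M (m≤n+m _ _) , ≤-trans y≤M (m≤n+m _ _)

-- Scaling by `D` turns a unit of slack into a margin `D`, which pays for any change between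
-- corrections in [0, D]; without slack the corrections agree. As `K` is at least the slack, `u`
-- never decreases, which makes backward crossings harmless.
scaled-near : ∀ D K u u′ w s ψ ψ′ → u′ + s ≡ u + (K + w) → s ≤ K → ψ ≤ D → ψ′ ≤ D → (s ≡ 0 → ψ ≡ ψ′) →
              Near (D * (K + w)) (D * u + ψ) (D * u′ + ψ′)
scaled-near D K u u′ w zero ψ ψ′ eq _ _ _ ψ≡ with ψ≡ refl
... | refl = ≤-trans (≤-trans (+-monoˡ-≤ ψ (*-monoʳ-≤ D u≤u′)) (m≤m+n _ _)) ≤-refl
           , ≤-reflexive (trans (cong (λ v → D * v + ψ) (trans (sym (+-identityʳ u′)) eq)) (ring D u (K + w) ψ))
  where
  ring : ∀ D u v ψ → D * (u + v) + ψ ≡ D * u + ψ + D * v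
  ring = solve-∀
  u≤u′ : u ≤ u′
  u≤u′ = ≤-trans (m≤m+n u _) (≤-reflexive (trans (sym eq) (+-identityʳ u′)))
scaled-near D K u u′ w s@(suc s-1) ψ ψ′ eq s≤K ψ≤ ψ′≤ _ = left , right
  where
  open ≤-Reasoning
  ring₁ : ∀ D u K w → D * u + D * (K + w) ≡ D * (u + (K + w))
  ring₁ = solve-∀
  ring₂ : ∀ D u ψ v → D * u + ψ + v ≡ (D * u + v) + ψ
  ring₂ = solve-∀
  u≤u′ : u ≤ u′
  u≤u′ = +-cancelʳ-≤ K u u′ (begin
    u + K         ≤⟨ +-monoʳ-≤ u (m≤m+n K w) ⟩
    u + (K + w)   ≡⟨ eq ⟨
    u′ + s        ≤⟨ +-monoʳ-≤ u′ s≤K ⟩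
    u′ + K        ∎)
  left : D * u + ψ ≤ D * u′ + ψ′ + D * (K + w)
  left = begin
    D * u + ψ                 ≤⟨ +-mono-≤ (*-monoʳ-≤ D u≤u′) ψ≤ ⟩
    D * u′ + D                ≤⟨ +-monoʳ-≤ (D * u′) 
                                   (m≤m*n D (K + w) ⦃ >-nonZero (≤-trans (s≤s z≤n) (≤-trans s≤K (m≤m+n K w))) ⦄) ⟩
    D * u′ + D * (K + w)      ≤⟨ +-monoˡ-≤ (D * (K + w)) (m≤m+n (D * u′) ψ′) ⟩
    D * u′ + ψ′ + D * (K + w) ∎
  right : D * u′ + ψ′ ≤ D * u + ψ + D * (K + w)
  right = begin
    D * u′ + ψ′               ≤⟨ +-monoʳ-≤ (D * u′) (≤-trans ψ′≤ (m≤m*n D s)) ⟩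
    D * u′ + D * s            ≡⟨ *-distribˡ-+ D u′ s ⟨
    D * (u′ + s)              ≡⟨ cong (D *_) eq ⟩
    D * (u + (K + w))         ≡⟨ ring₁ D u K w ⟨
    D * u + D * (K + w)       ≤⟨ +-monoˡ-≤ (D * (K + w)) (m≤m+n (D * u) ψ) ⟩
    D * u + ψ + D * (K + w)   ∎

-- A path of length k whose i-th vertex carries a pendant path of length (1 + R)(k ∸ i): once the
-- path is cut behind i*, the shortest way down from its start is the pendant path at i*, even if
-- the distances between the ends of the pendant paths are as small as 0 or as large as R.
module Selector (R k i* : ℕ) (i*<k : i* < k) where

  hang : ℕ → ℕ
  hang i = suc R * (k ∸ i)

  R≤hang : ∀ {i} → i < k → R ≤ hang i
  R≤hang {i} i<k = ≤-trans (n≤1+n R) (m≤m*n (suc R) (k ∸ i) ⦃ >-nonZero (m<n⇒0<n∸m i<k) ⦄)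

  -- Each index by which one leaves the path too early costs `suc R` on the pendant path: 1 offsets
  -- the saved walk and `R` the possible discrepancy below.
  earlier : ∀ {i} → i < i* → R + (i* ∸ i) + hang i* ≤ hang i
  earlier {i} i<i* = begin
    R + (i* ∸ i) + hang i*          ≡⟨ cong (_+ hang i*) (+-comm R (i* ∸ i)) ⟩
    (i* ∸ i) + R + hang i*          ≤⟨ +-monoˡ-≤ (hang i*) (+-monoʳ-≤ (i* ∸ i)
                                         (m≤m*n R (i* ∸ i) ⦃ >-nonZero (m<n⇒0<n∸m i<i*) ⦄)) ⟩
    suc R * (i* ∸ i) + hang i*      ≡⟨ *-distribˡ-+ (suc R) (i* ∸ i) (k ∸ i*) ⟨
    suc R * ((i* ∸ i) + (k ∸ i*))   ≡⟨ cong (suc R *_) 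
                                         (trans (+-comm (i* ∸ i) _) (m∸n+n∸o (<⇒≤ i*<k) (<⇒≤ i<i*))) ⟩
    hang i                          ∎
    where
    open ≤-Reasoning
    m∸n+n∸o : ∀ {m n o} → n ≤ m → o ≤ n → (m ∸ n) + (n ∸ o) ≡ m ∸ o
    m∸n+n∸o {m} {n} {o} n≤m o≤n = trans (sym (+-∸-assoc (m ∸ n) o≤n)) (cong (_∸ o) (m∸n+n≡m n≤m))

  -- Vertices beyond the cut get the value at the lower end of the selected pendant path; their own
  -- pendant paths have length at least `R` and absorb the difference.
  ascend : ℕ → ℕ → ℕ
  ascend c i = choose (i ≤? i*) (c + i) (c + (i* + hang i*))

  ascend-start : ∀ c → ascend c 0 ≡ c
  ascend-start c = +-identityʳ c

  ascend-unit : ∀ c i → i ≢ i* → Near 1 (ascend c i) (ascend c (suc i))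
  ascend-unit c i i≢i* with i ≤? i* | suc i ≤? i*
  ... | yes _    | yes _    = near-+ c (≤-trans (n≤1+n i) (m≤m+n (suc i) 1) , ≤-reflexive (+-comm 1 i))
  ... | yes i≤i* | no  i≮i* = contradiction (≤∧≢⇒< i≤i* i≢i*) i≮i*
  ... | no  i≰i* | yes i<i* = contradiction (<⇒≤ i<i*) i≰i*
  ... | no  _    | no  _    = m≤m+n _ _ , m≤m+n _ _

  ascend-hang : ∀ c i f → i < k → Near R f (c + (i* + hang i*)) → (i ≡ i* → f ≡ c + (i* + hang i*)) →
                Near (hang i) (ascend c i) f
  ascend-hang c i f i<k near at with i ≤? i*
  ... | no _ = near-mono (R≤hang i<k) (swap near)
  ... | yes i≤i* with m≤n⇒m<n∨m≡n i≤i*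
  ...   | inj₂ refl rewrite at refl =
          ≤-trans (+-monoʳ-≤ c (m≤m+n i (hang i))) (m≤m+n _ _) , ≤-reflexive (sym (+-assoc c i (hang i)))
  ...   | inj₁ i<i* = left , right
    where
    open ≤-Reasoning
    left : c + i ≤ f + hang i
    left = begin
      c + i                ≤⟨ +-monoʳ-≤ c (≤-trans i≤i* (m≤m+n i* (hang i*))) ⟩
      c + (i* + hang i*)   ≤⟨ proj₂ near ⟩
      f + R                ≤⟨ +-monoʳ-≤ f (R≤hang i<k) ⟩
      f + hang i           ∎
    ring : ∀ c i j h R → c + ((i + j) + h) + R ≡ c + i + ((R + j) + h)
    ring = solve-∀
    right : f ≤ c + i + hang i
    right = begin
      f                                       ≤⟨ proj₁ near ⟩
      c + (i* + hang i*) + R                  ≡⟨ cong (λ j → c + (j + hang i*) + R) (m+[n∸m]≡n i≤i*) ⟨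
      c + ((i + (i* ∸ i)) + hang i*) + R      ≡⟨ ring c i (i* ∸ i) (hang i*) R ⟩
      c + i + ((R + (i* ∸ i)) + hang i*)      ≤⟨ +-monoʳ-≤ (c + i) (earlier i<i*) ⟩
      c + i + hang i                          ∎

  -- The mirror image for the sink: the potential is `c` at the selected upper end and beyond the
  -- cut, and rises towards index 0.
  descend : ℕ → ℕ → ℕ
  descend c i = choose (i ≤? i*) (c + (hang i* + (i* ∸ i))) c

  descend-unit : ∀ c i → i ≢ i* → Near 1 (descend c (suc i)) (descend c i)
  descend-unit c i i≢i* with suc i ≤? i* | i ≤? i*
  ... | yes i<i* | yes _    =
        near-+ c (near-+ (hang i*) ( ≤-trans (∸-monoʳ-≤ i* (n≤1+n i)) (m≤m+n _ 1)
                                   , ≤-reflexive (trans (+-∸-assoc 1 i<i*) (+-comm 1 _))))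
  ... | no  i≮i* | yes i≤i* = contradiction (≤∧≢⇒< i≤i* i≢i*) i≮i*
  ... | yes i<i* | no  i≰i* = contradiction (<⇒≤ i<i*) i≰i*
  ... | no  _    | no  _    = m≤m+n _ _ , m≤m+n _ _

  descend-hang : ∀ c i f → i < k → Near R f c → (i ≡ i* → f ≡ c) → Near (hang i) f (descend c i)
  descend-hang c i f i<k near at with i ≤? i*
  ... | no _ = near-mono (R≤hang i<k) near
  ... | yes i≤i* with m≤n⇒m<n∨m≡n i≤i*
  ...   | inj₂ refl rewrite at refl | n∸n≡0 i | +-identityʳ (hang i) = ≤-trans (m≤m+n c (hang i)) (m≤m+n _ _) , ≤-refl
  ...   | inj₁ i<i* = left , right
    where
    open ≤-Reasoning
    left : f ≤ c + (hang i* + (i* ∸ i)) + hang i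
    left = begin
      f            ≤⟨ proj₁ near ⟩
      c + R        ≤⟨ +-mono-≤ (m≤m+n c _) (R≤hang i<k) ⟩
      c + (hang i* + (i* ∸ i)) + hang i ∎
    ring : ∀ f R j h → f + R + (h + j) ≡ f + ((R + j) + h)
    ring = solve-∀
    right : c + (hang i* + (i* ∸ i)) ≤ f + hang i
    right = begin
      c + (hang i* + (i* ∸ i))         ≤⟨ +-monoˡ-≤ _ (proj₂ near) ⟩
      f + R + (hang i* + (i* ∸ i))     ≡⟨ ring f R (i* ∸ i) (hang i*) ⟩
      f + ((R + (i* ∸ i)) + hang i*)   ≤⟨ +-monoʳ-≤ f (earlier i<i*) ⟩
      f + hang i                       ∎

-- The network

Σ-⊎↔ : ∀ {A B : Set} {F : A ⊎ B → Set} → Σ (A ⊎ B) F ↔ (Σ A (F ∘ inj₁) ⊎ Σ B (F ∘ inj₂))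
Σ-⊎↔ = mk↔ₛ′ (λ { (inj₁ a , x) → inj₁ (a , x) ; (inj₂ b , x) → inj₂ (b , x) })
             (λ { (inj₁ (a , x)) → inj₁ a , x ; (inj₂ (b , x)) → inj₂ b , x })
             (λ { (inj₁ _) → refl ; (inj₂ _) → refl })
             (λ { (inj₁ _ , _) → refl ; (inj₂ _ , _) → refl })

-- root and branch form the tree below the source and leaf the path at the sink. In round r, a line
-- through y leaves hub r y y′ in the first block, towards the port out; a bit edge switches blocks
-- to a port inn of a line through y′, which leads in the second block to the next hub.
pattern root i       = inj₁ i
pattern branch i j   = inj₂ (inj₁ (i , j))
pattern leaf h       = inj₂ (inj₂ (inj₁ h))
pattern hub r y y′   = inj₂ (inj₂ (inj₂ (inj₁ (r , y , y′))))
pattern out r x z y  = inj₂ (inj₂ (inj₂ (inj₂ (inj₁ (r , x , z , y)))))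
pattern inn r x z y  = inj₂ (inj₂ (inj₂ (inj₂ (inj₂ (r , x , z , y)))))

pattern root-edge i    = inj₁ i
pattern branch-edge i j = inj₂ (inj₁ (i , j))
pattern leaf-edge h    = inj₂ (inj₂ (inj₁ h))
pattern bit-edge r x z x′ z′ = inj₂ (inj₂ (inj₂ (r , (x , z) , (x′ , z′))))

pattern root-hang i     = inj₁ i
pattern branch-hang i j = inj₂ (inj₁ (i , j))
pattern leaf-hang h     = inj₂ (inj₂ (inj₁ h))
pattern hub-out r x z y = inj₂ (inj₂ (inj₂ (inj₁ (r , x , z , y))))
pattern inn-hub r x z y = inj₂ (inj₂ (inj₂ (inj₂ (r , x , z , y))))

module Construction {ℓ : ℕ} (ℓ>0 : 0 < ℓ) (block : Block ℓ) (K>0 : 0 < Block.maxWeight block) (extra : ℕ) where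
  open Block block

  -- `D` bounds the corrections ψ, `M` the potentials of the hubs, and `R` the descent through one
  -- branch. `M` and `R` are the tolerances of the selectors.
  κ λ′ K D M R : ℕ
  κ  = #X
  λ′ = #Z * #Z
  K  = maxWeight
  D  = ℓ * 2
  M  = D * (ℓ * (2 * K) + (maxPot + maxPot)) + D
  R  = κ + suc M * κ

  ZZ↔ : (Z × Z) ↔ Fin λ′
  ZZ↔ = Z↔ ×-code Z↔

  Port B U E : Set
  Port = Fin ℓ × X × Z × Y
  B = Fin (suc κ) ⊎ (Fin κ × Fin (suc κ)) ⊎ Fin (suc λ′) ⊎ (Fin (suc ℓ) × Y × Y) ⊎ Port ⊎ Port
  U = Fin κ ⊎ (Fin κ × Fin κ) ⊎ Fin λ′ ⊎ (Fin ℓ × (X × Z) × (X × Z))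
  E = Fin κ ⊎ (Fin κ × Fin κ) ⊎ Fin λ′ ⊎ Port ⊎ Port

  #Port #B #U #I : ℕ
  #Port = ℓ * (#X * (#Z * #Y))
  #B = suc κ + (κ * suc κ + (suc λ′ + (suc ℓ * (#Y * #Y) + (#Port + #Port))))
  #U = κ + (κ * κ + (λ′ + ℓ * ((#X * #Z) * (#X * #Z))))
  #I = κ * (suc R * κ) + ((κ * κ) * (suc M * κ) + (λ′ * (suc M * λ′) +
       (#Port * (D * (K + K)) + #Port * (D * (K + K)))))

  Port↔ : Port ↔ Fin #Port
  Port↔ = ↔-id _ ×-code X↔ ×-code Z↔ ×-code Y↔

  B↔ : B ↔ Fin #B
  B↔ = ↔-id _ ⊎-code (↔-id _ ×-code ↔-id _) ⊎-code ↔-id _ ⊎-code (↔-id _ ×-code Y↔ ×-code Y↔) ⊎-code Port↔ ⊎-code Port↔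

  U↔ : U ↔ Fin #U
  U↔ = ↔-id _ ⊎-code (↔-id _ ×-code ↔-id _) ⊎-code ↔-id _ ⊎-code
       (↔-id _ ×-code (X↔ ×-code Z↔) ×-code (X↔ ×-code Z↔))

  cap len : E → ℕ
  cap (root-hang i)     = suc R * κ
  cap (branch-hang i j) = suc M * κ
  cap (leaf-hang h)     = suc M * λ′
  cap (hub-out r x z y) = D * (K + K)
  cap (inn-hub r x z y) = D * (K + K)
  len (root-hang i)     = suc R * (κ ∸ toℕ i)
  len (branch-hang i j) = suc M * (κ ∸ toℕ j)
  len (leaf-hang h)     = suc M * (λ′ ∸ toℕ h)
  len (hub-out r x z y) = D * (K + weight x z)
  len (inn-hub r x z y) = D * (K + weight x z)

  I↔ : Σ E (Fin ∘ cap) ↔ Fin #I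
  I↔ = ((↔-id _ ×-code ↔-id _) ⊎-code
        (((↔-id _ ×-code ↔-id _) ×-code ↔-id _) ⊎-code
         ((↔-id _ ×-code ↔-id _) ⊎-code
          ((Port↔ ×-code ↔-id _) ⊎-code (Port↔ ×-code ↔-id _)) ↔-∘ Σ-⊎↔) ↔-∘ Σ-⊎↔) ↔-∘ Σ-⊎↔) ↔-∘ Σ-⊎↔

  usrc utgt : U → B
  usrc (root-edge i)           = root (inject₁ i)
  usrc (branch-edge i j)       = branch i (inject₁ j)
  usrc (leaf-edge h)           = leaf (suc h)
  -- The first block moves before the second: here the second is still at `pos r`, while the other
  -- end of the edge records the first at `pos (suc r)`.
  usrc (bit-edge r x z x′ z′)  = out r x z (pos (toℕ r) x′ z′)
  utgt (root-edge i)           = root (suc i)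
  utgt (branch-edge i j)       = branch i (suc j)
  utgt (leaf-edge h)           = leaf (inject₁ h)
  utgt (bit-edge r x z x′ z′)  = inn r x′ z′ (pos (suc (toℕ r)) x z)

  src tgt : E → B
  src (root-hang i)     = root (inject₁ i)
  src (branch-hang i j) = branch i (inject₁ j)
  src (leaf-hang h)     = hub (fromℕ ℓ) (last (proj₁ (Inverse.from ZZ↔ h))) (last (proj₂ (Inverse.from ZZ↔ h)))
  src (hub-out r x z y) = hub (inject₁ r) (pos (toℕ r) x z) y
  src (inn-hub r x z y) = inn r x z y
  tgt (root-hang i)     = branch i zero
  tgt (branch-hang i j) = hub zero (first (Inverse.from X↔ i)) (first (Inverse.from X↔ j))
  tgt (leaf-hang h)     = leaf (inject₁ h)
  tgt (hub-out r x z y) = out r x z y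
  tgt (inn-hub r x z y) = hub (suc r) y (pos (suc (toℕ r)) x z)

  D>0 : 0 < D
  D>0 = *-mono-≤ ℓ>0 (s≤s z≤n)

  hang>0 : ∀ R {k} (i : Fin k) → 0 < suc R * (k ∸ toℕ i)
  hang>0 R i = *-mono-≤ (s≤s (z≤n {R})) (m<n⇒0<n∸m (toℕ<n i))

  len>0 : ∀ e → 0 < len e
  len>0 (root-hang i)     = hang>0 R i
  len>0 (branch-hang i j) = hang>0 M j
  len>0 (leaf-hang h)     = hang>0 M h
  len>0 (hub-out r x z y) = *-mono-≤ D>0 (≤-trans K>0 (m≤m+n K _))
  len>0 (inn-hub r x z y) = *-mono-≤ D>0 (≤-trans K>0 (m≤m+n K _))

  len≤cap : ∀ e → len e ≤ cap e
  len≤cap (root-hang i)     = *-monoʳ-≤ (suc R) (m∸n≤m κ (toℕ i))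
  len≤cap (branch-hang i j) = *-monoʳ-≤ (suc M) (m∸n≤m κ (toℕ j))
  len≤cap (leaf-hang h)     = *-monoʳ-≤ (suc M) (m∸n≤m λ′ (toℕ h))
  len≤cap (hub-out r x z y) = *-monoʳ-≤ D (+-monoʳ-≤ K (weight≤ x z))
  len≤cap (inn-hub r x z y) = *-monoʳ-≤ D (+-monoʳ-≤ K (weight≤ x z))

  open Subdivision B↔ U↔ I↔ usrc utgt src tgt len len>0 len≤cap extra public

  Pair : Set
  Pair = (X × X) × (Z × Z)

  -- One bit governs the edges of its pair in all rounds `r`, which multiplies its effect by `ℓ`.
  bits : (Pair → Bool) → U → Bool
  bits χ (bit-edge r x z x′ z′) = χ ((x , x′) , (z , z′))
  bits χ _                      = true

  network : (Pair → Bool) → AdjMat (size + extra)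
  network χ = graph (switch (bits χ))

  source sink : Fin (size + extra)
  source = base (root zero)
  sink   = base (leaf zero)

  -- The potential certifying an unset bit

  module Target (x₁ x₂ : X) (z₁ z₂ : Z) where

    i₁ i₂ : Fin κ
    i₁ = Inverse.to X↔ x₁
    i₂ = Inverse.to X↔ x₂

    h* : Fin λ′
    h* = Inverse.to ZZ↔ (z₁ , z₂)

    module S₁ = Selector R κ (toℕ i₁) (toℕ<n i₁)
    module S₂ = Selector M κ (toℕ i₂) (toℕ<n i₂)
    module S₃ = Selector M λ′ (toℕ h*) (toℕ<n h*)

    -- Each fault is oriented like its unit edge, from `usrc` to `utgt`, as `unit-near` compares
    -- them literally.
    cut : List (B × B)
    cut = (root (inject₁ i₁) , root (suc i₁)) ∷ (branch i₁ (inject₁ i₂) , branch i₁ (suc i₂)) ∷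
          (leaf (suc h*) , leaf (inject₁ h*)) ∷ []

    OnHub : ℕ → Y → Y → Set
    OnHub r y y′ = y ≡ pos r x₁ z₁ × y′ ≡ pos r x₂ z₂

    OnOut AtOut OnInn AtInn : ℕ → X → Z → Y → Set
    OnOut r x z y = (x ≡ x₁ × z ≡ z₁) × y ≡ pos r x₂ z₂
    AtOut r x z y = pos (suc r) x z ≡ pos (suc r) x₁ z₁ × y ≡ pos r x₂ z₂
    OnInn r x z y = (x ≡ x₂ × z ≡ z₂) × y ≡ pos (suc r) x₁ z₁
    AtInn r x z y = pos r x z ≡ pos r x₂ z₂ × y ≡ pos (suc r) x₁ z₁

    _≟X_ : DecidableEquality X
    _≟X_ = ↔-≟ X↔
    _≟Y_ : DecidableEquality Y
    _≟Y_ = ↔-≟ Y↔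
    _≟Z_ : DecidableEquality Z
    _≟Z_ = ↔-≟ Z↔

    onHub? : ∀ r y y′ → Dec (OnHub r y y′)
    onHub? r y y′ = (y ≟Y _) ×-dec (y′ ≟Y _)
    onOut? : ∀ r x z y → Dec (OnOut r x z y)
    onOut? r x z y = ((x ≟X _) ×-dec (z ≟Z _)) ×-dec (y ≟Y _)
    atOut? : ∀ r x z y → Dec (AtOut r x z y)
    atOut? r x z y = (_ ≟Y _) ×-dec (y ≟Y _)
    onInn? : ∀ r x z y → Dec (OnInn r x z y)
    onInn? r x z y = ((x ≟X _) ×-dec (z ≟Z _)) ×-dec (y ≟Y _)
    atInn? : ∀ r x z y → Dec (AtInn r x z y)
    atInn? r x z y = (_ ≟Y _) ×-dec (y ≟Y _)

    -- The gain from the missing bit edges: 2 per round along the lines x₁z₁ and x₂z₂. The ports of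
    -- other lines at the same intersection lie halfway, so that each bit edge present gains at most 1.
    -- Elsewhere the gain is 0, which costs at most D and hence less than leaving the lines.
    ψhub : ℕ → Y → Y → ℕ
    ψhub r y y′ = choose (onHub? r y y′) (r * 2) 0

    ψout ψinn : ℕ → X → Z → Y → ℕ
    ψout r x z y = choose (onOut? r x z y) (r * 2) (choose (atOut? r x z y) (1 + r * 2) 0)
    ψinn r x z y = choose (onInn? r x z y) (2 + r * 2) (choose (atInn? r x z y) (1 + r * 2) 0)

    choose≤ : ∀ {P : Set} (d : Dec P) {a b n} → a ≤ n → b ≤ n → choose d a b ≤ n
    choose≤ (yes _) a≤n _ = a≤n
    choose≤ (no  _) _ b≤n = b≤n

    ψhub≤ : ∀ {r} → r ≤ ℓ → ∀ y y′ → ψhub r y y′ ≤ D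
    ψhub≤ r≤ℓ y y′ = choose≤ (onHub? _ y y′) (*-monoˡ-≤ 2 r≤ℓ) z≤n

    ψout≤ : ∀ {r} → r < ℓ → ∀ x z y → ψout r x z y ≤ D
    ψout≤ {r} r<ℓ x z y = choose≤ (onOut? r x z y) (*-monoˡ-≤ 2 (<⇒≤ r<ℓ))
      (choose≤ (atOut? r x z y) (≤-trans (n≤1+n _) (*-monoˡ-≤ 2 r<ℓ)) z≤n)

    ψinn≤ : ∀ {r} → r < ℓ → ∀ x z y → ψinn r x z y ≤ D
    ψinn≤ {r} r<ℓ x z y = choose≤ (onInn? r x z y) (*-monoˡ-≤ 2 r<ℓ)
      (choose≤ (atInn? r x z y) (≤-trans (n≤1+n _) (*-monoˡ-≤ 2 r<ℓ)) z≤n)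

    pot₁ pot₂ : ℕ → Y → ℕ
    pot₁ = pot x₁ z₁
    pot₂ = pot x₂ z₂

    -- Each round crosses two long edges, whose lengths contribute `K` apiece before scaling. At a
    -- port one of them is behind, and only the first block has advanced.
    uhub : ℕ → Y → Y → ℕ
    uhub r y y′ = r * (2 * K) + (pot₁ r y + pot₂ r y′)

    uport : ℕ → Y → Y → ℕ
    uport r y y′ = r * (2 * K) + K + (pot₁ (suc r) y + pot₂ r y′)

    hubPot : ℕ → Y → Y → ℕ
    hubPot r y y′ = D * uhub r y y′ + ψhub r y y′

    outPot innPot : ℕ → X → Z → Y → ℕ
    outPot r x z y = D * uport r (pos (suc r) x z) y + ψout r x z y
    innPot r x z y = D * uport r y (pos r x z) + ψinn r x z y

    hubPot≤ : ∀ {r} → r ≤ ℓ → ∀ y y′ → hubPot r y y′ ≤ M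
    hubPot≤ {r} r≤ℓ y y′ = +-mono-≤ (*-monoʳ-≤ D (+-mono-≤ (*-monoˡ-≤ (2 * K) r≤ℓ) (+-mono-≤ (pot≤ x₁ z₁ r y) (pot≤ x₂ z₂ r y′))))
                                    (ψhub≤ r≤ℓ y y′)

    hub-out-near : ∀ {r} → r < ℓ → ∀ x z y → Near (D * (K + weight x z)) (hubPot r (pos r x z) y) (outPot r x z y)
    hub-out-near {r} r<ℓ x z y =
      scaled-near D K (uhub r (pos r x z) y) (uport r (pos (suc r) x z) y) (weight x z) (slack x₁ z₁ x z)
        (ψhub r (pos r x z) y) (ψout r x z y)
        (ring (r * (2 * K)) K (pot₁ (suc r) (pos (suc r) x z)) (pot₁ r (pos r x z)) (pot₂ r y) _ _ (pot-step x₁ z₁ r<ℓ x z))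
        (slack≤ x₁ z₁ x z) (ψhub≤ (<⇒≤ r<ℓ) _ y) (ψout≤ r<ℓ x z y) same
      where
      ring₁ : ∀ N K p q s → N + K + (p + q) + s ≡ N + K + q + (p + s)
      ring₁ = solve-∀
      ring₂ : ∀ N K p q w → N + K + q + (p + w) ≡ N + (p + q) + (K + w)
      ring₂ = solve-∀
      ring : ∀ N K p p′ q s w → p + s ≡ p′ + w → N + K + (p + q) + s ≡ N + (p′ + q) + (K + w)
      ring N K p p′ q s w eq = trans (ring₁ N K p q s) (trans (cong (N + K + q +_) eq) (ring₂ N K p′ q w))
      -- Without slack the line is parallel to the target's. If they meet at either end of the step,
      -- they coincide by `rigid`; this excludes the halfway value.
      same : slack x₁ z₁ x z ≡ 0 → ψhub r (pos r x z) y ≡ ψout r x z y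
      same s≡0 with onHub? r (pos r x z) y | onOut? r x z y
      ... | yes _       | yes _                      = refl
      ... | yes (p , q) | no ¬on                     = contradiction (rigid x₁ z₁ x z (<⇒≤ r<ℓ) s≡0 p , q) ¬on
      ... | no ¬on      | yes ((refl , refl) , q)    = contradiction (refl , q) ¬on
      ... | no _        | no ¬on with atOut? r x z y
      ...   | yes (p , q) = contradiction (rigid x₁ z₁ x z r<ℓ s≡0 p , q) ¬on
      ...   | no _        = refl

    inn-hub-near : ∀ {r} → r < ℓ → ∀ x z y → Near (D * (K + weight x z)) (innPot r x z y) (hubPot (suc r) y (pos (suc r) x z))
    inn-hub-near {r} r<ℓ x z y =
      scaled-near D K (uport r y (pos r x z)) (uhub (suc r) y (pos (suc r) x z)) (weight x z) (slack x₂ z₂ x z)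
        (ψinn r x z y) (ψhub (suc r) y (pos (suc r) x z))
        (ring (r * (2 * K)) K (pot₁ (suc r) y) (pot₂ (suc r) (pos (suc r) x z)) (pot₂ r (pos r x z)) _ _ (pot-step x₂ z₂ r<ℓ x z))
        (slack≤ x₂ z₂ x z) (ψinn≤ r<ℓ x z y) (ψhub≤ r<ℓ y _) same
      where
      ring₁ : ∀ N K p q s → 2 * K + N + (p + q) + s ≡ N + K + K + p + (q + s)
      ring₁ = solve-∀
      ring₂ : ∀ N K p q w → N + K + K + p + (q + w) ≡ N + K + (p + q) + (K + w)
      ring₂ = solve-∀
      ring : ∀ N K p q q′ s w → q + s ≡ q′ + w → 2 * K + N + (p + q) + s ≡ N + K + (p + q′) + (K + w)
      ring N K p q q′ s w eq = trans (ring₁ N K p q s) (trans (cong (N + K + K + p +_) eq) (ring₂ N K p q′ w))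
      same : slack x₂ z₂ x z ≡ 0 → ψinn r x z y ≡ ψhub (suc r) y (pos (suc r) x z)
      same s≡0 with onHub? (suc r) y (pos (suc r) x z) | onInn? r x z y
      ... | yes _       | yes _                      = refl
      ... | yes (p , q) | no ¬on                     = contradiction (rigid x₂ z₂ x z r<ℓ s≡0 q , p) ¬on
      ... | no ¬on      | yes ((refl , refl) , q)    = contradiction (q , refl) ¬on
      ... | no _        | no ¬on with atInn? r x z y
      ...   | yes (p , q) = contradiction (rigid x₂ z₂ x z (<⇒≤ r<ℓ) s≡0 p , q) ¬on
      ...   | no _        = refl

    -- Both ends carry the same `uport`, and `AtOut` at one end is equivalent to `AtInn` at the
    -- other. So only ψ changes, and a jump by 2 needs both lines to be the target's.
    out-inn-near : ∀ r x z x′ z′ → ¬ ((x ≡ x₁ × z ≡ z₁) × (x′ ≡ x₂ × z′ ≡ z₂)) →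
                   Near 1 (outPot r x z (pos r x′ z′)) (innPot r x′ z′ (pos (suc r) x z))
    out-inn-near r x z x′ z′ off = near-+ (D * uport r (pos (suc r) x z) (pos r x′ z′)) ψ-near
      where
      ψ-near : Near 1 (ψout r x z (pos r x′ z′)) (ψinn r x′ z′ (pos (suc r) x z))
      ψ-near with onOut? r x z (pos r x′ z′) | onInn? r x′ z′ (pos (suc r) x z)
                | atOut? r x z (pos r x′ z′) | atInn? r x′ z′ (pos (suc r) x z)
      ... | yes (p , _)  | yes (q , _)  | _            | _            = contradiction (p , q) off
      ... | _            | _            | yes (p , q)  | no ¬at       = contradiction (q , p) ¬at
      ... | _            | _            | no ¬at       | yes (p , q)  = contradiction (q , p) ¬at
      ... | yes ((refl , refl) , q) | no _ | no ¬at    | no _         = contradiction (refl , q) ¬at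
      ... | no _         | yes ((refl , refl) , q) | no ¬at | no _    = contradiction (q , refl) ¬at
      ... | no _         | no _         | yes _        | yes _        = near-refl refl
      ... | no _         | no _         | no _         | no _         = z≤n , z≤n
      ... | yes _        | no _         | yes _        | yes _        = ≤-trans (n≤1+n _) (m≤m+n _ 1) , ≤-reflexive (+-comm 1 _)
      ... | no _         | yes _        | yes _        | yes _        = ≤-trans (n≤1+n _) (m≤m+n _ 1) , ≤-reflexive (+-comm 1 _)

    -- The values at the root, the selected branch, the selected start hub and the selected end hub.
    -- Starting from `c₀` instead of 0 avoids subtraction.
    offset c₀ c₁ c₂ c₃ : ℕ
    offset = (toℕ i₁ + S₁.hang (toℕ i₁)) + (toℕ i₂ + S₂.hang (toℕ i₂))
    c₀ = hubPot 0 (first x₁) (first x₂)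
    c₁ = c₀ + (toℕ i₁ + S₁.hang (toℕ i₁))
    c₂ = c₁ + (toℕ i₂ + S₂.hang (toℕ i₂))
    c₃ = offset + hubPot ℓ (last z₁) (last z₂)

    c₂≡ : c₂ ≡ offset + c₀
    c₂≡ = ring c₀ (toℕ i₁ + S₁.hang (toℕ i₁)) (toℕ i₂ + S₂.hang (toℕ i₂))
      where
      ring : ∀ c a b → c + a + b ≡ (a + b) + c
      ring = solve-∀

    potential : B → ℕ
    potential (root i)      = S₁.ascend c₀ (toℕ i)
    -- The other branches are constant: `c₂` is within `R` of `c₁` and within `M` of every start
    -- hub.
    potential (branch i j)  = choose (i Fin.≟ i₁) (S₂.ascend c₁ (toℕ j)) c₂
    potential (leaf h)      = S₃.descend c₃ (toℕ h)
    potential (hub r y y′)  = offset + hubPot (toℕ r) y y′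
    potential (out r x z y) = offset + outPot (toℕ r) x z y
    potential (inn r x z y) = offset + innPot (toℕ r) x z y

    unit-near : ∀ {χ} → χ ((x₁ , x₂) , (z₁ , z₂)) ≡ false → ∀ u → bits χ u ≡ true → (usrc u , utgt u) ∉ cut →
                Near 1 (potential (usrc u)) (potential (utgt u))
    unit-near _ (root-edge i) _ ∉cut rewrite toℕ-inject₁ i =
      S₁.ascend-unit c₀ (toℕ i) λ i≡ → ∉cut (here (cong (λ i → root (inject₁ i) , root (suc i)) (toℕ-injective i≡)))
    unit-near _ (branch-edge i j) _ ∉cut with i Fin.≟ i₁
    ... | no _ = near-refl refl
    ... | yes refl rewrite toℕ-inject₁ j =
      S₂.ascend-unit c₁ (toℕ j) λ j≡ → ∉cut (there (here
        (cong (λ j → branch i₁ (inject₁ j) , branch i₁ (suc j)) (toℕ-injective j≡))))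
    unit-near _ (leaf-edge h) _ ∉cut rewrite toℕ-inject₁ h =
      S₃.descend-unit c₃ (toℕ h) λ h≡ → ∉cut (there (there (here
        (cong (λ h → leaf (suc h) , leaf (inject₁ h)) (toℕ-injective h≡)))))
    unit-near off (bit-edge r x z x′ z′) on _ =
      near-+ offset (out-inn-near (toℕ r) x z x′ z′
        λ { ((refl , refl) , (refl , refl)) → contradiction (trans (sym on) off) λ () })

    hub-near : ∀ {r} → r ≤ ℓ → ∀ y y′ y″ y‴ → Near M (offset + hubPot r y y′) (offset + hubPot r y″ y‴)
    hub-near r≤ℓ y y′ y″ y‴ = near-+ offset (near-bounded (hubPot≤ r≤ℓ y y′) (hubPot≤ r≤ℓ y″ y‴))

    near-c₂ : ∀ i j → Near M (offset + hubPot 0 (first (Inverse.from X↔ i)) (first (Inverse.from X↔ j))) c₂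
    near-c₂ i j = subst (Near M (offset + hubPot 0 (first (Inverse.from X↔ i)) (first (Inverse.from X↔ j)))) (sym c₂≡)
      (hub-near z≤n (first (Inverse.from X↔ i)) (first (Inverse.from X↔ j)) (first x₁) (first x₂))

    long-near : ∀ e → Near (len e) (potential (src e)) (potential (tgt e))
    long-near (root-hang i) rewrite toℕ-inject₁ i = S₁.ascend-hang c₀ (toℕ i) _ (toℕ<n i) near at
      where
      near : Near R (potential (branch i zero)) c₁
      near with i Fin.≟ i₁
      ... | yes _ = near-refl (+-identityʳ c₁)
      ... | no  _ = +-monoʳ-≤ c₁ (+-mono-≤ (<⇒≤ (toℕ<n i₂)) (*-monoʳ-≤ (suc M) (m∸n≤m κ (toℕ i₂)))) ,
                    ≤-trans (m≤m+n c₁ _) (m≤m+n c₂ _)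
      at : toℕ i ≡ toℕ i₁ → potential (branch i zero) ≡ c₁
      at i≡ with i Fin.≟ i₁
      ... | yes _   = +-identityʳ c₁
      ... | no i≢i₁ = contradiction (toℕ-injective i≡) i≢i₁
    long-near (branch-hang i j) with i Fin.≟ i₁
    ... | no _ = near-mono (S₂.R≤hang (toℕ<n j)) (swap (near-c₂ i j))
    ... | yes refl rewrite toℕ-inject₁ j =
      S₂.ascend-hang c₁ (toℕ j) (offset + hubPot 0 (first (Inverse.from X↔ i)) (first (Inverse.from X↔ j)))
        (toℕ<n j) (near-c₂ i j) at
      where
      at : toℕ j ≡ toℕ i₂ → potential (hub zero (first (Inverse.from X↔ i₁)) (first (Inverse.from X↔ j))) ≡ c₂
      at j≡ = trans (cong₂ (λ x x′ → offset + hubPot 0 (first x) (first x′)) (Inverse.strictlyInverseʳ X↔ x₁)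
                           (trans (cong (Inverse.from X↔) (toℕ-injective j≡)) (Inverse.strictlyInverseʳ X↔ x₂))) (sym c₂≡)
    long-near (leaf-hang h) rewrite toℕ-inject₁ h | toℕ-fromℕ ℓ =
      S₃.descend-hang c₃ (toℕ h) (offset + hubPot ℓ (last (proj₁ (Inverse.from ZZ↔ h))) (last (proj₂ (Inverse.from ZZ↔ h))))
        (toℕ<n h) (hub-near ≤-refl (last (proj₁ (Inverse.from ZZ↔ h))) (last (proj₂ (Inverse.from ZZ↔ h))) (last z₁) (last z₂))
        λ h≡ → cong (λ (z , z′) → offset + hubPot ℓ (last z) (last z′))
                    (trans (cong (Inverse.from ZZ↔) (toℕ-injective h≡)) (Inverse.strictlyInverseʳ ZZ↔ (z₁ , z₂)))
    long-near (hub-out r x z y) rewrite toℕ-inject₁ r = near-+ offset (hub-out-near (toℕ<n r) x z y)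
    long-near (inn-hub r x z y) = near-+ offset (inn-hub-near (toℕ<n r) x z y)

    round route : ℕ
    round = D * (K + weight x₁ z₁) + 1 + D * (K + weight x₂ z₂)
    route = offset + ℓ * round + (S₃.hang (toℕ h*) + toℕ h*)

    -- A trajectory has no slack against itself, so `pot-step` telescopes.
    pot-last : ∀ x z → pot x z ℓ (last z) ≡ pot x z 0 (first x) + ℓ * weight x z
    pot-last x z = subst₂ (λ y y′ → pot x z ℓ y ≡ pot x z 0 y′ + ℓ * weight x z) (pos-last x z) (pos-first x z) (go ℓ ≤-refl)
      where
      ring : ∀ p w v → p + v + w ≡ p + (w + v)
      ring = solve-∀
      go : ∀ r → r ≤ ℓ → pot x z r (pos r x z) ≡ pot x z 0 (pos 0 x z) + r * weight x z
      go zero    _   = sym (+-identityʳ _)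
      go (suc r) r<ℓ = trans (sym (+-identityʳ _)) (trans (cong (_ +_) (sym (slack-self x z)))
        (trans (pot-step x z r<ℓ x z) (trans (cong (_+ weight x z) (go r (<⇒≤ r<ℓ))) (ring _ (weight x z) (r * weight x z)))))

    -- ψ rises from 0 to 2ℓ, while `round` counts only 1 for each bit edge; the surplus is `ℓ`.
    hub-gain : hubPot ℓ (last z₁) (last z₂) ≡ c₀ + ℓ * round + ℓ
    hub-gain with onHub? ℓ (last z₁) (last z₂) | onHub? 0 (first x₁) (first x₂)
    ... | no ¬on | _ = contradiction (sym (pos-last x₁ z₁) , sym (pos-last x₂ z₂)) ¬on
    ... | yes _  | no ¬on = contradiction (sym (pos-first x₁ z₁) , sym (pos-first x₂ z₂)) ¬on
    ... | yes _  | yes _ rewrite pot-last x₁ z₁ | pot-last x₂ z₂ =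
      ring D ℓ K (pot₁ 0 (first x₁)) (pot₂ 0 (first x₂)) (weight x₁ z₁) (weight x₂ z₂)
      where
      ring : ∀ D ℓ K p q w v → D * (ℓ * (2 * K) + ((p + ℓ * w) + (q + ℓ * v))) + ℓ * 2 ≡
                               D * (0 + (p + q)) + 0 + ℓ * (D * (K + w) + 1 + D * (K + v)) + ℓ
      ring = solve-∀

    route-lower : ∀ {χ k} → χ ((x₁ , x₂) , (z₁ , z₂)) ≡ false → Walk (network χ) (faults cut) source sink k → route + ℓ ≤ k
    route-lower {χ} {k} off w = +-cancelˡ-≤ c₀ _ _ (begin
      c₀ + (route + ℓ)
        ≡⟨ ring c₀ offset (ℓ * round) (S₃.hang (toℕ h*) + toℕ h*) ℓ ⟩
      offset + (c₀ + ℓ * round + ℓ) + (S₃.hang (toℕ h*) + toℕ h*)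
        ≡⟨ cong (λ c → offset + c + (S₃.hang (toℕ h*) + toℕ h*)) hub-gain ⟨
      potential (leaf zero)
        ≤⟨ potential-lower potential (unit-near {χ} off) long-near w ⟩
      potential (root zero) + k
        ≡⟨ cong (_+ k) (S₁.ascend-start c₀) ⟩
      c₀ + k ∎)
      where
      open ≤-Reasoning
      ring : ∀ c o r s ℓ → c + (o + r + s + ℓ) ≡ o + (c + r + ℓ) + s
      ring = solve-∀

    -- The route available when the bit is set

    Ok : B → Set
    Ok (root i)     = toℕ i ≤ toℕ i₁
    Ok (branch i j) = toℕ j ≤ toℕ i₂
    Ok (leaf h)     = toℕ h ≤ toℕ h*
    Ok _            = ⊤

    cut-hit : All (λ (x , y) → ¬ (Ok x × Ok y)) cut
    cut-hit = (λ (_ , ok) → <-irrefl refl ok) ∷ (λ (_ , ok) → <-irrefl refl ok) ∷ (λ (ok , _) → <-irrefl refl ok) ∷ []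

    inject₁≢suc : ∀ {n} (i : Fin n) → inject₁ i ≢ suc i
    inject₁≢suc i eq = 1+n≢n (sym (trans (sym (toℕ-inject₁ i)) (cong toℕ eq)))

    cut-valid : ∀ χ → ValidFaults 3 (network χ) (faults cut)
    cut-valid χ = ≤-refl ,
      graph-seg (inj₁ (root-edge i₁)) refl (λ eq → inject₁≢suc i₁ (inj₁-injective (inj₁-injective eq))) ∷
      graph-seg (inj₁ (branch-edge i₁ i₂)) refl
        (λ eq → inject₁≢suc i₂ (cong proj₂ (inj₁-injective (inj₂-injective (inj₁-injective eq))))) ∷
      graph-seg (inj₁ (leaf-edge h*)) refl
        (λ eq → inject₁≢suc h* (sym (inj₁-injective (inj₂-injective (inj₂-injective (inj₁-injective eq)))))) ∷ []

    module Route {χ : Pair → Bool} (on : χ ((x₁ , x₂) , (z₁ , z₂)) ≡ true) (Path : B → B → ℕ → Set)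
                 (ε : ∀ {x} → Path x x 0) (_▷_ : ∀ {x y z j k} → Path x y j → Path y z k → Path x z (j + k))
                 (unit : ∀ u → bits χ u ≡ true → Ok (usrc u) → Ok (utgt u) → Path (usrc u) (utgt u) 1)
                 (long : ∀ e → Ok (src e) → Ok (tgt e) → Path (src e) (tgt e) (len e)) where

      path-root : ∀ i → toℕ i ≤ toℕ i₁ → Path (root zero) (root i) (toℕ i)
      path-root = <-weakInduction (λ i → toℕ i ≤ toℕ i₁ → Path (root zero) (root i) (toℕ i)) (λ _ → ε) next
        where
        next : ∀ i → (toℕ (inject₁ i) ≤ toℕ i₁ → Path (root zero) (root (inject₁ i)) (toℕ (inject₁ i))) →
               suc (toℕ i) ≤ toℕ i₁ → Path (root zero) (root (suc i)) (suc (toℕ i))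
        next i ih i<i₁ rewrite toℕ-inject₁ i = subst (Path _ _) (+-comm (toℕ i) 1)
          (ih (<⇒≤ i<i₁) ▷ unit (root-edge i) refl (≤-trans (≤-reflexive (toℕ-inject₁ i)) (<⇒≤ i<i₁)) i<i₁)

      path-branch : ∀ j → toℕ j ≤ toℕ i₂ → Path (branch i₁ zero) (branch i₁ j) (toℕ j)
      path-branch = <-weakInduction (λ j → toℕ j ≤ toℕ i₂ → Path (branch i₁ zero) (branch i₁ j) (toℕ j)) (λ _ → ε) next
        where
        next : ∀ j → (toℕ (inject₁ j) ≤ toℕ i₂ → Path (branch i₁ zero) (branch i₁ (inject₁ j)) (toℕ (inject₁ j))) →
               suc (toℕ j) ≤ toℕ i₂ → Path (branch i₁ zero) (branch i₁ (suc j)) (suc (toℕ j))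
        next j ih j<i₂ rewrite toℕ-inject₁ j = subst (Path _ _) (+-comm (toℕ j) 1)
          (ih (<⇒≤ j<i₂) ▷ unit (branch-edge i₁ j) refl (≤-trans (≤-reflexive (toℕ-inject₁ j)) (<⇒≤ j<i₂)) j<i₂)

      path-leaf : ∀ h → toℕ h ≤ toℕ h* → Path (leaf h) (leaf zero) (toℕ h)
      path-leaf = <-weakInduction (λ h → toℕ h ≤ toℕ h* → Path (leaf h) (leaf zero) (toℕ h)) (λ _ → ε) next
        where
        next : ∀ h → (toℕ (inject₁ h) ≤ toℕ h* → Path (leaf (inject₁ h)) (leaf zero) (toℕ (inject₁ h))) →
               suc (toℕ h) ≤ toℕ h* → Path (leaf (suc h)) (leaf zero) (suc (toℕ h))
        next h ih h<h* rewrite toℕ-inject₁ h =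
          unit (leaf-edge h) refl h<h* (≤-trans (≤-reflexive (toℕ-inject₁ h)) (<⇒≤ h<h*)) ▷ ih (<⇒≤ h<h*)

      path-hub : ∀ r → Path (hub zero (pos 0 x₁ z₁) (pos 0 x₂ z₂)) (hub r (pos (toℕ r) x₁ z₁) (pos (toℕ r) x₂ z₂)) (toℕ r * round)
      path-hub = <-weakInduction (λ r → Path _ (hub r (pos (toℕ r) x₁ z₁) (pos (toℕ r) x₂ z₂)) (toℕ r * round)) ε next
        where
        next : ∀ r → Path (hub zero (pos 0 x₁ z₁) (pos 0 x₂ z₂))
                          (hub (inject₁ r) (pos (toℕ (inject₁ r)) x₁ z₁) (pos (toℕ (inject₁ r)) x₂ z₂)) (toℕ (inject₁ r) * round) →
               Path (hub zero (pos 0 x₁ z₁) (pos 0 x₂ z₂))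
                    (hub (suc r) (pos (suc (toℕ r)) x₁ z₁) (pos (suc (toℕ r)) x₂ z₂)) (round + toℕ r * round)
        next r ih rewrite toℕ-inject₁ r = subst (Path _ _) (+-comm (toℕ r * round) round)
          (ih ▷ ((long (hub-out r x₁ z₁ (pos (toℕ r) x₂ z₂)) tt tt ▷
                  unit (bit-edge r x₁ z₁ x₂ z₂) on tt tt) ▷
                 long (inn-hub r x₂ z₂ (pos (suc (toℕ r)) x₁ z₁)) tt tt))

      path-core : Path (hub zero (first x₁) (first x₂)) (hub (fromℕ ℓ) (last z₁) (last z₂)) (ℓ * round)
      path-core with path-hub (fromℕ ℓ)
      ... | path rewrite toℕ-fromℕ ℓ | pos-first x₁ z₁ | pos-first x₂ z₂ | pos-last x₁ z₁ | pos-last x₂ z₂ = path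

      inject₁≤ : ∀ {n} (i : Fin n) → toℕ (inject₁ i) ≤ toℕ i
      inject₁≤ i = ≤-reflexive (toℕ-inject₁ i)

      path-down-root : Path (root zero) (branch i₁ zero) (toℕ i₁ + S₁.hang (toℕ i₁))
      path-down-root = subst (λ n → Path (root zero) (branch i₁ zero) (n + S₁.hang (toℕ i₁))) (toℕ-inject₁ i₁)
        (path-root (inject₁ i₁) (inject₁≤ i₁) ▷ long (root-hang i₁) (inject₁≤ i₁) z≤n)

      path-down-branch : Path (branch i₁ zero) (hub zero (first x₁) (first x₂)) (toℕ i₂ + S₂.hang (toℕ i₂))
      path-down-branch = subst₂ (λ x x′ → Path (branch i₁ zero) (hub zero (first x) (first x′)) (toℕ i₂ + S₂.hang (toℕ i₂)))
        (Inverse.strictlyInverseʳ X↔ x₁) (Inverse.strictlyInverseʳ X↔ x₂)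
        (subst (λ n → Path (branch i₁ zero) (tgt (branch-hang i₁ i₂)) (n + S₂.hang (toℕ i₂))) (toℕ-inject₁ i₂)
          (path-branch (inject₁ i₂) (inject₁≤ i₂) ▷ long (branch-hang i₁ i₂) (inject₁≤ i₂) tt))

      path-up-leaf : Path (hub (fromℕ ℓ) (last z₁) (last z₂)) (leaf zero) (S₃.hang (toℕ h*) + toℕ h*)
      path-up-leaf = subst (λ (z , z′) → Path (hub (fromℕ ℓ) (last z) (last z′)) (leaf zero) (S₃.hang (toℕ h*) + toℕ h*))
        (Inverse.strictlyInverseʳ ZZ↔ (z₁ , z₂))
        (subst (λ n → Path (src (leaf-hang h*)) (leaf zero) (S₃.hang (toℕ h*) + n)) (toℕ-inject₁ h*)
          (long (leaf-hang h*) tt (inject₁≤ h*) ▷ path-leaf (inject₁ h*) (inject₁≤ h*)))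

      path-route : Path (root zero) (leaf zero) route
      path-route = ((path-down-root ▷ path-down-branch) ▷ path-core) ▷ path-up-leaf

    route-upper : ∀ {χ} → χ ((x₁ , x₂) , (z₁ , z₂)) ≡ true → ∃ λ k → k ≤ route × Walk (network χ) (faults cut) source sink k
    route-upper {χ} on = let conn k≤ w = path-route in _ , k≤ , w
      where
      open Clear {bits χ} {cut} Ok cut-hit
      open Route {χ} on Path conn-refl conn-trans path-unit path-long

-- Counting encodings

funToFin-cong : ∀ {m n} {f g : Fin m → Fin n} → (∀ i → f i ≡ g i) → funToFin f ≡ funToFin g
funToFin-cong {zero}  f≗g = refl
funToFin-cong {suc m} f≗g = cong₂ combine (f≗g zero) (funToFin-cong (f≗g ∘ suc))

finToFun-injective : ∀ {m n} {i j : Fin (n ^ m)} → (∀ k → finToFun {n} {m} i k ≡ finToFun {n} {m} j k) → i ≡ j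
finToFun-injective {m} {n} {i} {j} i≗j =
  trans (sym (funToFin-finToFin {m} {n} i)) (trans (funToFin-cong i≗j) (funToFin-finToFin {m} {n} j))

-- Bijective base 2.
value : List Bool → ℕ
value []           = 0
value (false ∷ bs) = 1 + 2 * value bs
value (true ∷ bs)  = 2 + 2 * value bs

value-injective : ∀ bs cs → value bs ≡ value cs → bs ≡ cs
value-injective []           []           _  = refl
value-injective []           (false ∷ cs) ()
value-injective []           (true ∷ cs)  ()
value-injective (false ∷ bs) []           ()
value-injective (true ∷ bs)  []           ()
value-injective (false ∷ bs) (false ∷ cs) eq = cong (false ∷_) (value-injective bs cs (*-cancelˡ-≡ _ _ 2 (suc-injective eq)))
value-injective (true ∷ bs)  (true ∷ cs)  eq = cong (true ∷_) (value-injective bs cs (*-cancelˡ-≡ _ _ 2 (suc-injective (suc-injective eq))))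
value-injective (false ∷ bs) (true ∷ cs)  eq = contradiction (suc-injective eq) (even≢odd (value bs) (value cs))
value-injective (true ∷ bs)  (false ∷ cs) eq = contradiction (sym (suc-injective eq)) (even≢odd (value cs) (value bs))

-- Strings of length below N thus have values at most 2^N - 2, which leaves 2^N - 1 values and lets
-- the pigeonhole principle apply to 2^N codes.
value-bound : ∀ bs → 2 + value bs ≤ 2 ^ suc (length bs)
value-bound []       = ≤-refl
value-bound (b ∷ bs) = ≤-trans (digit b) (*-monoʳ-≤ 2 (value-bound bs))
  where
  ring : ∀ v → 2 + (2 + 2 * v) ≡ 2 * (2 + v)
  ring = solve-∀
  digit : ∀ b → 2 + value (b ∷ bs) ≤ 2 * (2 + value bs)
  digit true  = ≤-reflexive (ring (value bs))
  digit false = ≤-trans (n≤1+n _) (≤-reflexive (ring (value bs)))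

¬-short-injection : ∀ {N} (f : Fin (2 ^ N) → List Bool) → (∀ i j → f i ≡ f j → i ≡ j) → ¬ (∀ i → length (f i) < N)
¬-short-injection {N} f f-injective short =
  let i , j , i<j , eq = pigeonhole (≤-reflexive (suc-pred (2 ^ N) ⦃ m^n≢0 2 N ⦄)) (λ i → fromℕ< (small i))
      fi≡fj = value-injective (f i) (f j) (trans (sym (toℕ-fromℕ< (small i))) (trans (cong toℕ eq) (toℕ-fromℕ< (small j))))
  in <⇒≢ i<j (cong toℕ (f-injective i j fi≡fj))
  where
  small : ∀ i → value (f i) < pred (2 ^ N)
  small i = pred-mono-≤ (≤-trans (value-bound (f i)) (^-monoʳ-≤ 2 (short i)))

-- Each bit χ q of the network shows up as a gap in one distance that an oracle with β < ℓ resolves.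
module _ {n f ℓ β N : ℕ} {Q : Set} (Q↔ : Q ↔ Fin N)
         (network : (Q → Bool) → AdjMat n) (s t : Fin n) (faults : Q → FaultSet n) (route : Q → ℕ)
         (isGraph : ∀ χ → IsGraph (network χ))
         (valid : ∀ χ q → ValidFaults f (network χ) (faults q))
         (upper : ∀ χ q → χ q ≡ true → ∃ λ k → k ≤ route q × Walk (network χ) (faults q) s t k)
         (lower : ∀ χ q → χ q ≡ false → ∀ k → Walk (network χ) (faults q) s t k → route q + ℓ ≤ k)
         (β<ℓ : β < ℓ) where

  -- A common answer `d` would satisfy route + ℓ ≤ d ≤ route + β. The answer `nothing` is refuted by
  -- the walk that a set bit provides.
  gap : ∀ {d χ χ′ q} → Approx β (network χ) (faults q) s t d → Approx β (network χ′) (faults q) s t d →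
        χ q ≡ true → ¬ (χ′ q ≡ false)
  gap {nothing} {χ} {χ′} {q} none _ on _ = let k , _ , w = upper χ q on in none k w
  gap {just d} {χ} {χ′} {q} (_ , near) ((j , w′ , j≤d) , _) on off =
    let k , k≤ , w = upper χ q on in
    <⇒≱ β<ℓ (+-cancelˡ-≤ (route q) _ _ (begin
      route q + ℓ   ≤⟨ lower χ′ q off j w′ ⟩
      j             ≤⟨ j≤d ⟩
      d             ≤⟨ near k w ⟩
      k + β         ≤⟨ +-monoˡ-≤ β k≤ ⟩
      route q + β   ∎))
    where open ≤-Reasoning

  χ : Fin (2 ^ N) → Q → Bool
  χ i q = Inverse.to Fin.2↔Bool (finToFun {2} {N} i (Inverse.to Q↔ q))

  -- The faults of `q` are the same for all `χ`, so equal codes receive equal answers and `gap`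
  -- forces equal bits. Hence the 2^N codes are distinct.
  oracle-lower : ∀ (enc : AdjMat n → Fin n → Fin n → List Bool) (query : List Bool → FaultSet n → Maybe ℕ) →
                 IsOracle n f β enc query → ∃[ G ] ∃[ s ] ∃[ t ] (IsGraph G × N ≤ length (enc G s t))
  oracle-lower enc query oracle with any? (λ i → N ≤? length (enc (network (χ i)) s t))
  ... | yes (i , long) = _ , s , t , isGraph _ , long
  ... | no ¬long = contradiction (λ i → ≰⇒> λ long → ¬long (i , long)) (¬-short-injection (code ∘ χ) code-injective)
    where
    code : (Q → Bool) → List Bool
    code b = enc (network b) s t
    approx : ∀ b q → Approx β (network b) (faults q) s t (query (code b) (faults q))
    approx b q = oracle (network b) s t (isGraph b) (faults q) (valid b q)
    bit≡ : ∀ b b′ q → code b ≡ code b′ → b q ≡ b′ q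
    bit≡ b b′ q eq with b q in e | b′ q in e′
    ... | true  | true  = refl
    ... | false | false = refl
    ... | true  | false = contradiction e′ (gap {χ = b} {χ′ = b′}
          (subst (λ c → Approx β (network b) (faults q) s t (query c (faults q))) eq (approx b q)) (approx b′ q) e)
    ... | false | true  = contradiction e (gap {χ = b′} {χ′ = b} (approx b′ q)
          (subst (λ c → Approx β (network b) (faults q) s t (query c (faults q))) eq (approx b q)) e′)
    code-injective : ∀ i j → code (χ i) ≡ code (χ j) → i ≡ j
    code-injective i j eq = finToFun-injective {N} {2} λ k →
      subst (λ k → finToFun {2} {N} i k ≡ finToFun {2} {N} j k) (Inverse.strictlyInverseˡ Q↔ k)
        (trans (sym (Inverse.strictlyInverseʳ Fin.2↔Bool _))
          (trans (cong (Inverse.from Fin.2↔Bool) (bit≡ (χ i) (χ j) (Inverse.from Q↔ k) eq)) (Inverse.strictlyInverseʳ Fin.2↔Bool _)))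

-- The size of the network

#X-grid : ∀ {ℓ} (ℓ>0 : 0 < ℓ) d A C → Block.#X (grid ℓ ℓ>0 d A C) ≡ A ^ d
#X-grid ℓ>0 zero    A C = refl
#X-grid ℓ>0 (suc d) A C = cong (A *_) (#X-grid ℓ>0 d A C)

#Z-grid : ∀ {ℓ} (ℓ>0 : 0 < ℓ) d A C → Block.#Z (grid ℓ ℓ>0 d A C) ≡ C ^ d
#Z-grid ℓ>0 zero    A C = refl
#Z-grid ℓ>0 (suc d) A C = cong (C *_) (#Z-grid ℓ>0 d A C)

#Y-grid : ∀ {ℓ} (ℓ>0 : 0 < ℓ) d A C → Block.#Y (grid ℓ ℓ>0 d A C) ≡ suc (ℓ * (A + C)) ^ d
#Y-grid ℓ>0 zero    A C = refl
#Y-grid {ℓ} ℓ>0 (suc d) A C = cong (suc (ℓ * (A + C)) *_) (#Y-grid ℓ>0 d A C)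

maxWeight-grid : ∀ {ℓ} (ℓ>0 : 0 < ℓ) d A C → Block.maxWeight (grid ℓ ℓ>0 d A C) ≡ d * ((A + C) * (A + C))
maxWeight-grid ℓ>0 zero    A C = refl
maxWeight-grid ℓ>0 (suc d) A C = cong ((A + C) * (A + C) +_) (maxWeight-grid ℓ>0 d A C)

maxPot-grid : ∀ {ℓ} (ℓ>0 : 0 < ℓ) d A C →
              Block.maxPot (grid ℓ ℓ>0 d A C) ≡ d * (2 * ((A + C) * (ℓ * (A + C))) + ℓ * ((A + C) * (A + C)))
maxPot-grid ℓ>0 zero    A C = refl
maxPot-grid {ℓ} ℓ>0 (suc d) A C = cong (2 * ((A + C) * (ℓ * (A + C))) + ℓ * ((A + C) * (A + C)) +_) (maxPot-grid ℓ>0 d A C)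

module Asymptotics (m : ℕ) (16≤m : 16 ≤ m) where

  instance
    m≢0 : NonZero m
    m≢0 = >-nonZero (≤-trans (s≤s z≤n) 16≤m)

  2≤m : 2 ≤ m
  2≤m = ≤-trans (s≤s (s≤s z≤n)) 16≤m

  infix 4 _⊑_
  record _⊑_ (x e : ℕ) : Set where
    constructor bound
    field below : x ≤ m ^ e
  open _⊑_

  weaken : ∀ {x e f} → e ≤ f → x ⊑ e → x ⊑ f
  weaken e≤f (bound x≤) = bound (≤-trans x≤ (^-monoʳ-≤ m e≤f))

  infixl 6 _⊕_
  infixl 7 _⊙_

  _⊙_ : ∀ {x y e f} → x ⊑ e → y ⊑ f → x * y ⊑ e + f
  _⊙_ {e = e} {f} (bound x≤) (bound y≤) = bound (≤-trans (*-mono-≤ x≤ y≤) (≤-reflexive (sym (^-distribˡ-+-* m e f))))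

  -- The factor 2 of a sum is paid by one extra power of `m`.
  _⊕_ : ∀ {x y e f} → x ⊑ e → y ⊑ f → x + y ⊑ suc (e ⊔ f)
  _⊕_ {x} {y} {e} {f} bx by = bound (begin
    x + y                            ≤⟨ +-mono-≤ (below (weaken (m≤m⊔n e f) bx)) (below (weaken (m≤n⊔m e f) by)) ⟩
    m ^ (e ⊔ f) + m ^ (e ⊔ f)        ≡⟨ ring (m ^ (e ⊔ f)) ⟩
    2 * m ^ (e ⊔ f)                  ≤⟨ *-monoˡ-≤ (m ^ (e ⊔ f)) 2≤m ⟩
    m ^ suc (e ⊔ f)                  ∎)
    where
    open ≤-Reasoning
    ring : ∀ x → x + x ≡ 2 * x
    ring = solve-∀

  _⊙^_ : ∀ {x e} → x ⊑ e → ∀ d → x ^ d ⊑ e * d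
  _⊙^_ {e = e} (bound x≤) d = bound (≤-trans (^-monoˡ-≤ d x≤) (≤-reflexive (^-*-assoc m e d)))

  one : 1 ⊑ 0
  one = bound ≤-refl

  small : ∀ {c} → c ≤ 16 → c ⊑ 1
  small c≤16 = bound (≤-trans (≤-trans c≤16 16≤m) (≤-reflexive (sym (*-identityʳ m))))

  var : m ⊑ 1
  var = bound (≤-reflexive (sym (*-identityʳ m)))

  m>0 : 0 < m
  m>0 = ≤-trans (s≤s z≤n) 2≤m

  module Sizes (block : Block m) (K>0 : 0 < Block.maxWeight block)
    (#X⊑ : Block.#X block ⊑ 128) (#Z⊑ : Block.#Z block ⊑ 96) (#Y⊑ : Block.#Y block ⊑ 176)
    (K⊑ : Block.maxWeight block ⊑ 19) (Π⊑ : Block.maxPot block ⊑ 22) where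

    open Construction m>0 block K>0 0 using (κ; λ′; D; M; R; #Port; #B; #I; size)

    two : 2 ⊑ 1
    two = small (from-yes (2 ≤? 16))

    D⊑ : D ⊑ 2
    D⊑ = var ⊙ two

    M⊑ : M ⊑ 27
    M⊑ = D⊑ ⊙ (var ⊙ (two ⊙ K⊑) ⊕ (Π⊑ ⊕ Π⊑)) ⊕ D⊑

    sucM⊑ : suc M ⊑ 28
    sucM⊑ = one ⊕ M⊑

    λ⊑ : λ′ ⊑ 192
    λ⊑ = #Z⊑ ⊙ #Z⊑

    #Port⊑ : #Port ⊑ 401
    #Port⊑ = var ⊙ (#X⊑ ⊙ (#Z⊑ ⊙ #Y⊑))

    R⊑ : suc R ⊑ 158
    R⊑ = one ⊕ (#X⊑ ⊕ sucM⊑ ⊙ #X⊑)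

    #B⊑ : #B ⊑ 406
    #B⊑ = (one ⊕ #X⊑) ⊕ (#X⊑ ⊙ (one ⊕ #X⊑) ⊕ ((one ⊕ λ⊑) ⊕ ((one ⊕ var) ⊙ (#Y⊑ ⊙ #Y⊑) ⊕ (#Port⊑ ⊕ #Port⊑))))

    #I⊑ : #I ⊑ 427
    #I⊑ = #X⊑ ⊙ (R⊑ ⊙ #X⊑) ⊕ ((#X⊑ ⊙ #X⊑) ⊙ (sucM⊑ ⊙ #X⊑) ⊕ (λ⊑ ⊙ (sucM⊑ ⊙ λ⊑) ⊕
          (#Port⊑ ⊙ (D⊑ ⊙ (K⊑ ⊕ K⊑)) ⊕ #Port⊑ ⊙ (D⊑ ⊙ (K⊑ ⊕ K⊑)))))

    size⊑ : size ⊑ 446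
    -- The estimates give 428. The exponent 446 lies two below that of the bits: one power is lost
    -- in rounding `n` and one remains as gain.
    size⊑ = weaken (from-yes (428 ≤? 446)) (#B⊑ ⊕ #I⊑)

  -- The exponents c are separate variables lest Agda unfold powers with literal exponents.
  ^-+ : ∀ a b {c} → a + b ≡ c → m ^ c ≡ m ^ a * m ^ b
  ^-+ a b refl = ^-distribˡ-+-* m a b

  ^-^ : ∀ a b {c} → a * b ≡ c → (m ^ a) ^ b ≡ m ^ c
  ^-^ a b refl = ^-*-assoc m a b

  module Instance (block : Block m) (K>0 : 0 < Block.maxWeight block)
    (#X≥ : m ^ 128 ≤ Block.#X block) (#Z≥ : m ^ 96 ≤ Block.#Z block)
    (extra : ℕ) where

    open Construction m>0 block K>0 extra

    Pair↔ : Pair ↔ Fin ((κ * κ) * λ′)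
    Pair↔ = (Block.X↔ block ×-code Block.X↔ block) ×-code ZZ↔

    module At (q : Pair) = Target (proj₁ (proj₁ q)) (proj₂ (proj₁ q)) (proj₁ (proj₂ q)) (proj₂ (proj₂ q))

    bits≥ : m ^ 448 ≤ (κ * κ) * λ′
    bits≥ = ≤-trans (≤-reflexive (trans (^-+ 256 192 refl) (cong₂ _*_ (^-+ 128 128 refl) (^-+ 96 96 refl))))
      (*-mono-≤ (*-mono-≤ #X≥ #X≥) (*-mono-≤ #Z≥ #Z≥))

    lower-bound : ∀ {β} → β < m → ∀ enc query → IsOracle (size + extra) 3 β enc query →
                  ∃[ G ] ∃[ s ] ∃[ t ] (IsGraph G × m ^ 448 ≤ length (enc G s t))
    lower-bound β<m enc query oracle =
      let G , s , t , isGraph , long = oracle-lower Pair↔ network source sink (λ q → faults (At.cut q)) At.route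
            (λ χ → graph-isGraph (switch (bits χ))) (λ χ q → At.cut-valid q χ)
            (λ χ q on → At.route-upper q {χ} on) (λ χ q off k w → At.route-lower q {χ} off w) β<m enc query oracle
      in G , s , t , isGraph , ≤-trans bits≥ long

  lower-bound-at : (block : Block m) → 0 < Block.maxWeight block →
    Block.#X block ≡ (m ^ 8) ^ 16 → Block.#Z block ≡ (m ^ 6) ^ 16 →
    Block.#Y block ⊑ 176 → Block.maxWeight block ⊑ 19 → Block.maxPot block ⊑ 22 →
    ∀ {n β} → m ^ 446 ≤ n → β < m → ∀ enc query → IsOracle n 3 β enc query →
    ∃[ G ] ∃[ s ] ∃[ t ] (IsGraph G × m ^ 448 ≤ length (enc G s t))
  lower-bound-at block K>0 #X≡ #Z≡ #Y⊑ K⊑ Π⊑ {β = β} m^446≤n β<m =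
    go (m≤n⇒∃[o]m+o≡n (≤-trans (below (Sizes.size⊑ block K>0 (bound (≤-reflexive #X≡′)) (bound (≤-reflexive #Z≡′)) #Y⊑ K⊑ Π⊑)) m^446≤n))
    where
    -- `size` is the same for every padding, so it is computed with none; `extra` then fills up to
    -- `n`.
    open Construction m>0 block K>0 0 using (size)
    #X≡′ : Block.#X block ≡ m ^ 128
    #X≡′ = trans #X≡ (^-^ 8 16 refl)
    #Z≡′ : Block.#Z block ≡ m ^ 96
    #Z≡′ = trans #Z≡ (^-^ 6 16 refl)
    go : ∀ {n} → (∃ λ extra → size + extra ≡ n) → ∀ enc query → IsOracle n 3 β enc query →
         ∃[ G ] ∃[ s ] ∃[ t ] (IsGraph G × m ^ 448 ≤ length (enc G s t))
    go (extra , refl) = Instance.lower-bound block K>0 (≤-reflexive (sym #X≡′)) (≤-reflexive (sym #Z≡′)) extra β<m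

  lower-bound-for : ∀ {n β} → m ^ 446 ≤ n → β < m → ∀ enc query → IsOracle n 3 β enc query →
                    ∃[ G ] ∃[ s ] ∃[ t ] (IsGraph G × m ^ 448 ≤ length (enc G s t))
  lower-bound-for = lower-bound-at (grid m m>0 16 A C) K>0 (#X-grid m>0 16 A C) (#Z-grid m>0 16 A C) #Y⊑ K⊑ Π⊑
    where
    A C : ℕ
    -- Each coordinate has m^14 lines but at most m^11 positions. In 16 coordinates the surplus m^48
    -- outweighs the rounds, lengths and sums. The ratio 8 : 6 balances the tree, of order #X³, with
    -- the pendant paths at the sink, of order #Z⁴, up to the factor `M`.
    A = m ^ 8
    C = m ^ 6
    A>0 : 0 < A + C
    A>0 = ≤-trans (m^n>0 m 8) (m≤m+n A C)
    K>0 : 0 < Block.maxWeight (grid m m>0 16 A C)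
    K>0 = ≤-trans (*-mono-≤ (s≤s (z≤n {15})) (*-mono-≤ A>0 A>0)) (≤-reflexive (sym (maxWeight-grid m>0 16 A C)))
    A⊑ : A ⊑ 8
    A⊑ = bound ≤-refl
    C⊑ : C ⊑ 6
    C⊑ = bound ≤-refl
    side : A + C ⊑ 9
    side = A⊑ ⊕ C⊑
    #Y⊑ : Block.#Y (grid m m>0 16 A C) ⊑ 176
    #Y⊑ = subst (_⊑ 176) (sym (#Y-grid m>0 16 A C)) ((one ⊕ var ⊙ side) ⊙^ 16)
    K⊑ : Block.maxWeight (grid m m>0 16 A C) ⊑ 19
    K⊑ = subst (_⊑ 19) (sym (maxWeight-grid m>0 16 A C)) (small ≤-refl ⊙ (side ⊙ side))
    Π⊑ : Block.maxPot (grid m m>0 16 A C) ⊑ 22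
    Π⊑ = subst (_⊑ 22) (sym (maxPot-grid m>0 16 A C))
      (small ≤-refl ⊙ (small (from-yes (2 ≤? 16)) ⊙ (side ⊙ (var ⊙ side)) ⊕ var ⊙ (side ⊙ side)))

-- Integer roots and the passage to all n

root-between : ∀ e n → ∃ λ m → m ^ suc e ≤ n × n < suc m ^ suc e
root-between e zero = 0 , ≤-refl , m^n>0 1 (suc e)
root-between e (suc n) with root-between e n
-- Passing from `n` to `suc n` raises the root by at most 1.
... | m , m^≤n , n<m+1^ with suc m ^ suc e ≤? suc n
...   | no m+1^≰1+n = m , m≤n⇒m≤1+n m^≤n , ≰⇒> m+1^≰1+n
...   | yes m+1^≤1+n = suc m , m+1^≤1+n , ≤-<-trans n<m+1^ (^-monoˡ-< (suc e) ≤-refl)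

^-distribʳ-* : ∀ e a b → (a * b) ^ e ≡ a ^ e * b ^ e
^-distribʳ-* zero    a b = refl
^-distribʳ-* (suc e) a b = trans (cong (a * b *_) (^-distribʳ-* e a b)) (ring a b (a ^ e) (b ^ e))
  where
  ring : ∀ a b c d → a * b * (c * d) ≡ a * c * (b * d)
  ring = solve-∀

LowerBound : (E m₀ : ℕ) → Set
LowerBound E m₀ = ∀ {m} → m₀ ≤ m → ∀ {n β} → m ^ E ≤ n → β < m → ∀ enc query → IsOracle n 3 β enc query →
  ∃[ G ] ∃[ s ] ∃[ t ] (IsGraph G × m ^ (suc E + 1) ≤ length (enc G s t))

-- With m the integer part of the E-th root of n, n ≤ m ^ (E + 1) as soon as 2 ^ E ≤ m.
rescale : ∀ e m₀ → LowerBound (suc e) m₀ → ∃[ n₀ ]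
  (∀ n → n₀ ≤ n → ∀ β → β ^ suc (suc e) ≤ n ^ 1 → ∀ enc query → IsOracle n 3 β enc query →
   ∃[ G ] ∃[ s ] ∃[ t ] (IsGraph G × n ^ (suc (suc e) + 1) ≤ (1 * length (enc G s t)) ^ suc (suc e)))
-- This threshold forces the integer root above `m₀ + 2 ^ E`, as `lower` and `growth` both require.
rescale e m₀ lower = (m₀ + 2 ^ E) ^ E , λ n n₀≤n β β≤ enc query oracle →
  let m , m^≤n , n<m+1^ = root-between e n
      m₀+2^≤m = ≮⇒≥ λ m< → <⇒≱ n<m+1^ (≤-trans (^-monoˡ-≤ E m<) n₀≤n)
      n<m^ = growth m (≤-trans (m≤n+m (2 ^ E) m₀) m₀+2^≤m) n<m+1^
      G , s , t , isGraph , long = lower (≤-trans (m≤m+n m₀ _) m₀+2^≤m) m^≤n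
        -- If m ≤ β, then m^(E+1) ≤ β^(E+1) ≤ n, contrary to `growth`.
        (≰⇒> λ m≤β → <⇒≱ n<m^ (≤-trans (^-monoˡ-≤ (suc E) m≤β) (≤-trans β≤ (≤-reflexive (*-identityʳ n))))) enc query oracle
  in G , s , t , isGraph , (begin
       n ^ (suc E + 1)                      ≤⟨ ^-monoˡ-≤ (suc E + 1) (<⇒≤ n<m^) ⟩
       (m ^ suc E) ^ (suc E + 1)            ≡⟨ ^-*-assoc m (suc E) (suc E + 1) ⟩
       m ^ (suc E * (suc E + 1))            ≡⟨ cong (m ^_) (*-comm (suc E) (suc E + 1)) ⟩
       m ^ ((suc E + 1) * suc E)            ≡⟨ ^-*-assoc m (suc E + 1) (suc E) ⟨
       (m ^ (suc E + 1)) ^ suc E            ≤⟨ ^-monoˡ-≤ (suc E) long ⟩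
       length (enc G s t) ^ suc E           ≡⟨ cong (_^ suc E) (*-identityˡ (length (enc G s t))) ⟨
       (1 * length (enc G s t)) ^ suc E     ∎)
  where
  open ≤-Reasoning
  E : ℕ
  E = suc e
  growth : ∀ m → 2 ^ E ≤ m → ∀ {n} → n < suc m ^ E → n < m ^ suc E
  growth m 2^≤m {n} n< = begin-strict
    n              <⟨ n< ⟩
    suc m ^ E      ≤⟨ ^-monoˡ-≤ E (+-monoˡ-≤ m (≤-trans (m^n>0 2 E) 2^≤m)) ⟩
    (m + m) ^ E    ≡⟨ cong (λ k → (m + k) ^ E) (+-identityʳ m) ⟨
    (2 * m) ^ E    ≡⟨ ^-distribʳ-* E 2 m ⟩
    2 ^ E * m ^ E  ≤⟨ *-monoˡ-≤ (m ^ E) 2^≤m ⟩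
    m ^ suc E      ∎

theorem6 : ∃[ p ] ∃[ q ] ∃[ a ] ∃[ b ] ∃[ C ] ∃[ n₀ ]
    (∀ (n : ℕ) → n₀ ≤ n →
    ∀ (β : ℕ) → β ^ suc q ≤ n ^ suc p →
    ∀ (enc : AdjMat n → Fin n → Fin n → List Bool)
    (query : List Bool → FaultSet n → Maybe ℕ) →
    IsOracle n 3 β enc query →
    ∃[ G ] ∃[ s ] ∃[ t ]
    (IsGraph G × n ^ (suc b + suc a) ≤ (suc C * length (enc G s t)) ^ suc b))
-- The exponents are δ = ε = 1/447, with constant 1; numerators, denominators and the constant are
-- stored as predecessors.
theorem6 = 0 , 446 , 0 , 446 , 0 , rescale 445 16 (λ {m} 16≤m → Asymptotics.lower-bound-for m 16≤m)
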